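{- Let $\Gamma$ be a signed graph in which every connected component contains at least two vertices. Then $\eta(\Gamma)=2c(\Gamma)+p(\Gamma)$ if and only if every connected component of $\Gamma$ is a signed cycle with nullity $2$.
   Context: All graphs are simple and finite. A signed graph $\Gamma=(G,\sigma)$ consists of a simple graph $G$ and a map $\sigma:E(G)\to\{+,-\}$; its adjacency matrix has $(i,j)$-entry $\sigma(v_iv_j)$ if $v_i\sim v_j$ and $0$ otherwise. $\eta(\Gamma)$ denotes the multiplicity of the eigenvalue $0$ of the adjacency matrix. $c(\Gamma)=|E(G)|-|V(G)|+\omega(G)$ is the cyclomatic number ($\omega(G)$ the number of components), and $p(\Gamma)$ is the number of vertices of degree one in $G$. A signed cycle is a signed graph whose underlying graph is a cycle. -}

module Defs where

open import Data.Nat using (ℕ; zero; suc; _∸_; _≤_; _<ᵇ_)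
import Data.Nat
open import Data.Fin using (Fin; toℕ; _≟_)
import Data.Fin as Fin
open import Data.Bool using (Bool; true; false; _∧_; _∨_; not; if_then_else_; T)
open import Data.Maybe using (Maybe; just; nothing; is-just)
open import Data.Sign using (Sign)
open import Data.List using (List; allFin; map)
open import Data.Nat.ListAction using (sum)
open import Data.Bool.ListAction using (any)
open import Data.Product using (Σ; ∃; _×_; _,_)
open import Data.Sum using (_⊎_)
open import Data.Rational using (ℚ; 0ℚ; 1ℚ; -_) renaming (_+_ to _+ℚ_; _*_ to _*ℚ_)
open import Relation.Binary.PropositionalEquality using (_≡_)
open import Relation.Nullary using (¬_)
open import Relation.Nullary.Decidable using (⌊_⌋)
open import Function.Definitions using (Injective)
open import Function.Bundles using (_⇔_)

-- Signed graphs on vertex set Fin n.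
-- w i j = nothing : i and j are not adjacent
-- w i j = just s  : i ~ j with sign s (Sign.+ or Sign.-)
record SignedGraph (n : ℕ) : Set where
  field
    w      : Fin n → Fin n → Maybe Sign
    sym    : ∀ i j → w i j ≡ w j i
    irrefl : ∀ i → w i i ≡ nothing
open SignedGraph public

adj : ∀ {n} → SignedGraph n → Fin n → Fin n → Bool
adj G i j = is-just (w G i j)

entry : Maybe Sign → ℚ
entry nothing = 0ℚ
entry (just Sign.+) = 1ℚ
entry (just Sign.-) = - 1ℚ

A : ∀ {n} → SignedGraph n → Fin n → Fin n → ℚ
A G i j = entry (w G i j)

sumℚ : ∀ {k} → (Fin k → ℚ) → ℚ
sumℚ {zero} f = 0ℚ
sumℚ {suc k} f = f Fin.zero +ℚ sumℚ (λ i → f (Fin.suc i))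

countB : ∀ {n} → (Fin n → Bool) → ℕ
countB {n} p = sum (map (λ i → if p i then 1 else 0) (allFin n))

-- Nullity η: dimension of the null space of the adjacency matrix
-- (over ℚ; the matrix is symmetric with integer entries, so this equals
-- the multiplicity of eigenvalue 0).
InKernel : ∀ {n} → SignedGraph n → (Fin n → ℚ) → Set
InKernel G x = ∀ i → sumℚ (λ j → A G i j *ℚ x j) ≡ 0ℚ

LinIndep : ∀ {n k} → (Fin k → Fin n → ℚ) → Set
LinIndep {n} {k} v =
  (c : Fin k → ℚ) → (∀ j → sumℚ (λ i → c i *ℚ v i j) ≡ 0ℚ) → ∀ i → c i ≡ 0ℚ

Nullity : ∀ {n} → SignedGraph n → ℕ → Set
Nullity {n} G k =
  (Σ (Fin k → Fin n → ℚ) λ v → (∀ i → InKernel G (v i)) × LinIndep v)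
  × ((v : Fin (suc k) → Fin n → ℚ) → (∀ i → InKernel G (v i)) → ¬ LinIndep v)

walkB : ∀ {n} → SignedGraph n → ℕ → Fin n → Fin n → Bool
walkB G zero i j = ⌊ i ≟ j ⌋
walkB {n} G (suc k) i j = walkB G k i j ∨ any (λ l → walkB G k i l ∧ adj G l j) (allFin n)

Reach : ∀ {n} → SignedGraph n → Fin n → Fin n → Set
Reach {n} G i j = T (walkB G n i j)

numEdges : ∀ {n} → SignedGraph n → ℕ
numEdges {n} G = sum (map (λ i → countB (λ j → (toℕ i <ᵇ toℕ j) ∧ adj G i j)) (allFin n))

degree : ∀ {n} → SignedGraph n → Fin n → ℕ
degree G i = countB (λ j → adj G i j)

pendant : ∀ {n} → SignedGraph n → ℕ
pendant G = countB (λ i → ⌊ degree G i Data.Nat.≟ 1 ⌋)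

-- ω(Γ): number of components = number of vertices that are the least
-- vertex (in Fin order) of their component
components : ∀ {n} → SignedGraph n → ℕ
components {n} G =
  countB (λ i → not (any (λ j → (toℕ j <ᵇ toℕ i) ∧ walkB G n i j) (allFin n)))

-- c(Γ) = |E| - |V| + ω  (always ≥ 0, so truncated subtraction is exact)
cyclomatic : ∀ {n} → SignedGraph n → ℕ
cyclomatic {n} G = (numEdges G Data.Nat.+ components G) ∸ n

induce : ∀ {n m} → SignedGraph n → (Fin m → Fin n) → SignedGraph m
induce G g = record
  { w = λ i j → w G (g i) (g j)
  ; sym = λ i j → sym G (g i) (g j)
  ; irrefl = λ i → irrefl G (g i) }

CycSucc : ∀ {m} → Fin m → Fin m → Set
CycSucc {m} i j = toℕ j ≡ suc (toℕ i) ⊎ (suc (toℕ i) ≡ m × toℕ j ≡ 0)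

IsSignedCycle : ∀ {m} → SignedGraph m → Set
IsSignedCycle {m} H =
  3 ≤ m × Σ (Fin m → Fin m) λ π → Injective _≡_ _≡_ π ×
    (∀ i j → T (adj H (π i) (π j)) ⇔ (CycSucc i j ⊎ CycSucc j i))

ComponentIsCycleNullity2 : ∀ {n} → SignedGraph n → Fin n → Set
ComponentIsCycleNullity2 {n} G v =
  Σ ℕ λ m → Σ (Fin m → Fin n) λ g → Injective _≡_ _≡_ g ×
    (∀ u → Reach G v u ⇔ (∃ λ i → g i ≡ u)) ×
    IsSignedCycle (induce G g) × Nullity (induce G g) 2

{-# OPTIONS --safe #-}

-- Every degree being positive, 2c + p = 2ω + Σ max(deg v − 2, 0) =: N by the handshake lemma.
-- The nullity is at most N by zero forcing: choose a root and one neighbour in each component; whenever a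
-- vertex whose value is known to be zero has unknown neighbours, choose all but one of them, at most
-- deg v − 2, and the equation at v forces the last one.  If the nullity is N, then no run of this process can
-- choose fewer than N vertices, and arbitrary values on the chosen vertices extend to a kernel vector.
-- Start at v and a neighbour u and postpone v as long as possible.  If v then has a second known neighbour
-- and deg v ≥ 3, a choice is saved, which is impossible.  If u is the only one, a kernel vector with values 0 at v
-- and 1 at u, restricted to the known vertices, is mapped by A to a nonzero multiple of e_v; as A is symmetric,
-- every kernel vector vanishes at v, which is impossible too.  So the graph is 2-regular, each component
-- is a cycle, and the kernel vectors with prescribed values at v and u restrict to a basis on it.
-- Conversely, for a disjoint union of such cycles N = 2ω, and the kernel vectors of the cycles, extended by zero,
-- are 2ω independent kernel vectors.
module Submission where

open import Defs
open import Algebra.Bundles using (CommutativeRing)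
import Algebra.Properties.CommutativeMonoid.Sum as CommutativeMonoidSum
import Algebra.Properties.Semiring.Sum as SemiringSum
open import Data.Bool using (Bool; true; false; _∧_; not; if_then_else_; T)
open import Data.Bool.ListAction using (any)
open import Data.Bool.Properties using (T?; T-∧; T-∨; T-≡)
open import Data.Fin using (Fin; zero; suc; toℕ; fromℕ<; punchIn; punchOut; combine; remQuot; _≟_)
import Data.Fin as Fin
open import Data.Fin.Induction using (<-wellFounded)
import Data.Fin.Properties as Fin
open import Data.List using (List; []; _∷_; _++_; map; length; filter; allFin; tabulate; lookup)
import Data.List.Membership.DecPropositional as DecMembership
open import Data.List.Membership.Propositional using (_∈_; _∉_; find; lose)
open import Data.List.Membership.Propositional.Properties using (∈-∃++; ∈-filter⁺; ∈-filter⁻; ∈-allFin; ∈-++⁺ˡ; ∈-++⁺ʳ; ∈-++⁻; ∈-map⁻; ∈-lookup)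
open import Data.List.Properties using (length-tabulate; map-tabulate; length-map; length-++)
open import Data.List.Relation.Unary.All using ([]; _∷_)
import Data.List.Relation.Unary.All as All
open import Data.List.Relation.Unary.All.Properties using (¬Any⇒All¬)
open import Data.List.Relation.Unary.AllPairs using (AllPairs; []; _∷_)
import Data.List.Relation.Unary.AllPairs as AllPairs
import Data.List.Relation.Unary.AllPairs.Properties as AllPairs
open import Data.List.Relation.Unary.Any using (here; there; index)
open import Data.List.Relation.Unary.Any.Properties using (any⁺; any⁻; lookup-index)
open import Data.List.Relation.Unary.Unique.Propositional using (Unique)
import Data.List.Relation.Unary.Unique.Propositional.Properties as Unique
open import Data.Maybe using (just; nothing; is-just)
open import Data.Nat using (ℕ; zero; suc; _+_; _*_; _∸_; _≤_; _<_; _<ᵇ_; s≤s; z≤n)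
import Data.Nat as ℕ
open import Data.Nat.ListAction using (sum)
import Data.Nat.Properties as ℕ
open import Data.Nat.Tactic.RingSolver using (solve-∀)
open import Data.Product using (Σ; ∃; _×_; _,_; proj₁; proj₂)
open import Data.Rational using (ℚ; 0ℚ; 1ℚ; -_; 1/_; ≢-nonZero) renaming (_+_ to _+ℚ_; _*_ to _*ℚ_)
import Data.Rational.Properties as ℚ
open import Data.Rational.Solver using (module +-*-Solver)
open import Data.Sign using (Sign)
open import Data.Sum using (_⊎_; inj₁; inj₂; [_,_]′)
import Data.Sum as Sum
open import Data.Unit using (tt)
open import Function using (_∘_; id; case_of_)
open import Function.Bundles using (_⇔_; mk⇔; Equivalence)
open import Function.Definitions using (Injective)
open import Induction.WellFounded using (Acc; acc)
open import Relation.Binary.Construct.Closure.ReflexiveTransitive using (Star; ε; _◅_; _◅◅_; reverse)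
open import Relation.Binary.PropositionalEquality as ≡ using (_≡_; _≢_; refl; cong; cong₂; trans; subst; module ≡-Reasoning)
open import Relation.Nullary using (¬_; Dec; yes; no; contradiction)
open import Relation.Nullary.Decidable using (⌊_⌋; _×-dec_; ¬?; decidable-stable; toWitness; fromWitness)

open +-*-Solver using (solve; _:=_; _:*_; _:+_; :-_; con)

private
  module Σℚ = SemiringSum (CommutativeRing.semiring ℚ.+-*-commutativeRing)
  module Σℕ = CommutativeMonoidSum ℕ.+-0-commutativeMonoid

-- Finite-dimensional linear algebra over ℚ

sumℚ≡sum : ∀ {k} (f : Fin k → ℚ) → sumℚ f ≡ Σℚ.sum f
sumℚ≡sum {zero}  f = refl
sumℚ≡sum {suc k} f = cong (f zero +ℚ_) (sumℚ≡sum (f ∘ suc))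

sumℚ-cong : ∀ {k} {f g : Fin k → ℚ} → (∀ i → f i ≡ g i) → sumℚ f ≡ sumℚ g
sumℚ-cong {zero}  e = refl
sumℚ-cong {suc k} e = cong₂ _+ℚ_ (e zero) (sumℚ-cong (e ∘ suc))

sumℚ-zero : ∀ {k} {f : Fin k → ℚ} → (∀ i → f i ≡ 0ℚ) → sumℚ f ≡ 0ℚ
sumℚ-zero {zero}  e = refl
sumℚ-zero {suc k} e = trans (cong₂ _+ℚ_ (e zero) (sumℚ-zero (e ∘ suc))) (ℚ.+-identityˡ 0ℚ)

sumℚ-+ : ∀ {k} (f g : Fin k → ℚ) → sumℚ (λ i → f i +ℚ g i) ≡ sumℚ f +ℚ sumℚ g
sumℚ-+ f g = trans (sumℚ≡sum (λ i → f i +ℚ g i)) (trans (Σℚ.∑-distrib-+ f g) (≡.sym (cong₂ _+ℚ_ (sumℚ≡sum f) (sumℚ≡sum g))))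

sumℚ-*ˡ : ∀ {k} a (f : Fin k → ℚ) → sumℚ (λ i → a *ℚ f i) ≡ a *ℚ sumℚ f
sumℚ-*ˡ a f = trans (sumℚ≡sum (λ i → a *ℚ f i)) (≡.sym (trans (cong (a *ℚ_) (sumℚ≡sum f)) (Σℚ.*-distribˡ-sum a f)))

sumℚ-*ʳ : ∀ {k} a (f : Fin k → ℚ) → sumℚ (λ i → f i *ℚ a) ≡ sumℚ f *ℚ a
sumℚ-*ʳ a f = trans (sumℚ-cong λ i → ℚ.*-comm (f i) a) (trans (sumℚ-*ˡ a f) (ℚ.*-comm a _))

sumℚ-swap : ∀ {k l} (f : Fin k → Fin l → ℚ) →
  sumℚ (λ i → sumℚ (f i)) ≡ sumℚ (λ j → sumℚ (λ i → f i j))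
sumℚ-swap f = begin
  sumℚ (λ i → sumℚ (f i))          ≡⟨ sumℚ-cong (λ i → sumℚ≡sum (f i)) ⟩
  sumℚ (λ i → Σℚ.sum (f i))           ≡⟨ sumℚ≡sum (λ i → Σℚ.sum (f i)) ⟩
  Σℚ.sum (λ i → Σℚ.sum (f i))            ≡⟨ Σℚ.∑-comm f ⟩
  Σℚ.sum (λ j → Σℚ.sum (λ i → f i j))    ≡⟨ sumℚ≡sum (λ j → Σℚ.sum (λ i → f i j)) ⟨
  sumℚ (λ j → Σℚ.sum (λ i → f i j))   ≡⟨ sumℚ-cong (λ j → sumℚ≡sum (λ i → f i j)) ⟨
  sumℚ (λ j → sumℚ (λ i → f i j))  ∎
  where open ≡-Reasoning

sumℚ-remove : ∀ {k} (i : Fin (suc k)) (f : Fin (suc k) → ℚ) →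
  sumℚ f ≡ f i +ℚ sumℚ (f ∘ punchIn i)
sumℚ-remove i f = trans (sumℚ≡sum f)
  (trans (Σℚ.sum-remove {i = i} f) (cong (f i +ℚ_) (≡.sym (sumℚ≡sum (f ∘ punchIn i)))))

infixl 8 _∖_
-- Setting an entry to zero, rather than deleting it, keeps the index type `Fin n`, so that
-- `sumℚ-injection` can recurse without changing the codomain of `g`.
_∖_ : ∀ {n} → (Fin n → ℚ) → Fin n → Fin n → ℚ
(f ∖ a) i = if ⌊ i ≟ a ⌋ then 0ℚ else f i

∖-same : ∀ {n} (f : Fin n → ℚ) a → (f ∖ a) a ≡ 0ℚ
∖-same f a with a ≟ a
... | yes _ = refl
... | no ¬p = contradiction refl ¬p

∖-other : ∀ {n} (f : Fin n → ℚ) {a i} → i ≢ a → (f ∖ a) i ≡ f i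
∖-other f {a} {i} i≢a with i ≟ a
... | yes p = contradiction p i≢a
... | no _ = refl

sumℚ-∖ : ∀ {n} (f : Fin n → ℚ) a → sumℚ f ≡ f a +ℚ sumℚ (f ∖ a)
sumℚ-∖ {suc n} f a = begin
  sumℚ f                                ≡⟨ sumℚ-remove a f ⟩
  f a +ℚ sumℚ (f ∘ punchIn a)           ≡⟨ cong (f a +ℚ_) (sumℚ-cong λ i → ∖-other f (Fin.punchInᵢ≢i a i)) ⟨
  f a +ℚ sumℚ ((f ∖ a) ∘ punchIn a)     ≡⟨ cong (f a +ℚ_) (ℚ.+-identityˡ (sumℚ ((f ∖ a) ∘ punchIn a))) ⟨
  f a +ℚ (0ℚ +ℚ sumℚ ((f ∖ a) ∘ punchIn a)) ≡⟨ cong (λ z → f a +ℚ (z +ℚ sumℚ ((f ∖ a) ∘ punchIn a))) (∖-same f a) ⟨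
  f a +ℚ ((f ∖ a) a +ℚ sumℚ ((f ∖ a) ∘ punchIn a)) ≡⟨ cong (f a +ℚ_) (sumℚ-remove a (f ∖ a)) ⟨
  f a +ℚ sumℚ (f ∖ a)                   ∎
  where open ≡-Reasoning

-- Induction on `m`: once the term at `g zero` is split off and zeroed, the remaining function is
-- supported on the image of `g ∘ suc`.
sumℚ-injection : ∀ {m n} (g : Fin m → Fin n) → Injective _≡_ _≡_ g →
  (f : Fin n → ℚ) → (∀ j → (∀ i → g i ≢ j) → f j ≡ 0ℚ) →
  sumℚ f ≡ sumℚ (f ∘ g)
sumℚ-injection {zero}  g inj f z = sumℚ-zero (λ j → z j λ ())
sumℚ-injection {suc m} g inj f z = begin
  sumℚ f                                 ≡⟨ sumℚ-∖ f g₀ ⟩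
  f g₀ +ℚ sumℚ (f ∖ g₀)                  ≡⟨ cong (f g₀ +ℚ_) (sumℚ-injection (g ∘ suc) (λ e → Fin.suc-injective (inj e)) (f ∖ g₀) z′) ⟩
  f g₀ +ℚ sumℚ ((f ∖ g₀) ∘ g ∘ suc)      ≡⟨ cong (f g₀ +ℚ_) (sumℚ-cong {m} λ i → ∖-other f {g₀} {g (suc i)} (λ e → Fin.0≢1+n (≡.sym (inj e)))) ⟩
  f g₀ +ℚ sumℚ (f ∘ g ∘ suc)             ∎
  where
  open ≡-Reasoning
  g₀ = g zero
  z′ : ∀ j → (∀ i → g (suc i) ≢ j) → (f ∖ g₀) j ≡ 0ℚ
  z′ j h with j ≟ g₀
  ... | yes _  = refl
  ... | no j≢ = z j λ { zero e → j≢ (≡.sym e) ; (suc i) → h i }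

sumℚ-single : ∀ {n} (a : Fin n) (f : Fin n → ℚ) → (∀ j → j ≢ a → f j ≡ 0ℚ) → sumℚ f ≡ f a
sumℚ-single a f z = trans (sumℚ-injection {1} (λ _ → a) (λ { {zero} {zero} _ → refl }) f (λ j h → z j (λ e → h zero (≡.sym e))))
  (ℚ.+-identityʳ _)

*-nonzero-cancel : ∀ {a b} → a ≢ 0ℚ → a *ℚ b ≡ 0ℚ → b ≡ 0ℚ
*-nonzero-cancel {a} {b} a≢0 e = begin
  b                    ≡⟨ ℚ.*-identityˡ b ⟨
  1ℚ *ℚ b              ≡⟨ cong (_*ℚ b) (ℚ.*-inverseˡ a) ⟨
  (1/ a *ℚ a) *ℚ b     ≡⟨ ℚ.*-assoc (1/ a) a b ⟩
  1/ a *ℚ (a *ℚ b)     ≡⟨ cong (1/ a *ℚ_) e ⟩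
  1/ a *ℚ 0ℚ           ≡⟨ ℚ.*-zeroʳ (1/ a) ⟩
  0ℚ                   ∎
  where
  open ≡-Reasoning
  instance _ = ≢-nonZero a≢0

-- Gaussian elimination on the first column.
nontrivial-relation : ∀ m {k} → m < k → (M : Fin k → Fin m → ℚ) →
  Σ (Fin k → ℚ) λ c → (∃ λ i → c i ≢ 0ℚ) × (∀ j → sumℚ (λ i → c i *ℚ M i j) ≡ 0ℚ)
nontrivial-relation zero {suc k} _ M = (λ _ → 1ℚ) , (zero , λ ()) , λ ()
nontrivial-relation (suc m) {suc k} (s≤s m<k) M with Fin.any? (λ i → ¬? (M i zero ℚ.≟ 0ℚ))
... | no none with nontrivial-relation m (ℕ.m≤n⇒m≤1+n m<k) (λ i j → M i (suc j))
...   | c , c≢0 , rel = c , c≢0 , λ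
  { zero → sumℚ-zero (λ i → trans (cong (c i *ℚ_) (column-zero i)) (ℚ.*-zeroʳ (c i)))
  ; (suc j) → rel j }
  where
  column-zero : ∀ i → M i zero ≡ 0ℚ
  column-zero i = decidable-stable (M i zero ℚ.≟ 0ℚ) (λ h → none (i , h))
nontrivial-relation (suc m) {suc k} (s≤s m<k) M | yes (p , Mp≢0) =
  c , (punchIn p (proj₁ c′≢0) , λ e → proj₂ c′≢0 (trans (≡.sym (c-punchIn _)) e)) , λ
  { zero → trans (split zero) (trans (cong (- sumℚ t *ℚ M p zero +ℚ_) (sumℚ-cong {k} λ i → pivot-column (c′ i) (M (punchIn p i) zero)))
                                     (cancel zero))
  ; (suc j) → begin
      sumℚ (λ i → c i *ℚ M i (suc j))   ≡⟨ split (suc j) ⟩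
      - sumℚ t *ℚ M p (suc j) +ℚ sumℚ (λ i → c′ i *ℚ M (punchIn p i) (suc j))
        ≡⟨ cong (_+ℚ sumℚ (λ i → c′ i *ℚ M (punchIn p i) (suc j))) (negate (sumℚ t) (M p (suc j))) ⟩
      (- 1ℚ) *ℚ (sumℚ t *ℚ M p (suc j)) +ℚ sumℚ (λ i → c′ i *ℚ M (punchIn p i) (suc j))
        ≡⟨ cong (λ z → (- 1ℚ) *ℚ z +ℚ sumℚ (λ i → c′ i *ℚ M (punchIn p i) (suc j))) (sumℚ-*ʳ (M p (suc j)) t) ⟨
      (- 1ℚ) *ℚ sumℚ (λ i → t i *ℚ M p (suc j)) +ℚ sumℚ (λ i → c′ i *ℚ M (punchIn p i) (suc j))
        ≡⟨ cong (_+ℚ sumℚ (λ i → c′ i *ℚ M (punchIn p i) (suc j))) (sumℚ-*ˡ (- 1ℚ) (λ i → t i *ℚ M p (suc j))) ⟨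
      sumℚ (λ i → (- 1ℚ) *ℚ (t i *ℚ M p (suc j))) +ℚ sumℚ (λ i → c′ i *ℚ M (punchIn p i) (suc j))
        ≡⟨ sumℚ-+ (λ i → (- 1ℚ) *ℚ (t i *ℚ M p (suc j))) (λ i → c′ i *ℚ M (punchIn p i) (suc j)) ⟨
      sumℚ (λ i → (- 1ℚ) *ℚ (t i *ℚ M p (suc j)) +ℚ c′ i *ℚ M (punchIn p i) (suc j))
        ≡⟨ sumℚ-cong {k} (λ i → rearrange (c′ i) (M (punchIn p i) zero) q (M p (suc j)) (M (punchIn p i) (suc j))) ⟩
      sumℚ (λ i → c′ i *ℚ M′ i j)       ≡⟨ rel′ j ⟩
      0ℚ                                ∎ }
  where
  open ≡-Reasoning
  instance _ = ≢-nonZero Mp≢0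
  q = 1/ (M p zero)
  -- The other rows after clearing their first entries with the pivot row `p`; the first column is
  -- then dropped.
  M′ : Fin k → Fin m → ℚ
  M′ i j = M (punchIn p i) (suc j) +ℚ - (M (punchIn p i) zero *ℚ q *ℚ M p (suc j))
  IH = nontrivial-relation m m<k M′
  c′ = proj₁ IH
  c′≢0 = proj₁ (proj₂ IH)
  rel′ = proj₂ (proj₂ IH)
  t : Fin k → ℚ
  t i = c′ i *ℚ (M (punchIn p i) zero *ℚ q)
  -- The relation between the cleared rows subtracts row `p` with total weight `sumℚ t`; this
  -- becomes the coefficient of row `p`.
  c : Fin (suc k) → ℚ
  c i with p ≟ i
  ... | yes _ = - sumℚ t
  ... | no p≢i = c′ (punchOut p≢i)
  c-pivot : c p ≡ - sumℚ t
  c-pivot with p ≟ p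
  ... | yes _ = refl
  ... | no ¬e = contradiction refl ¬e
  c-punchIn : ∀ i → c (punchIn p i) ≡ c′ i
  c-punchIn i with p ≟ punchIn p i
  ... | yes e = contradiction (≡.sym e) (Fin.punchInᵢ≢i p i)
  ... | no _ = cong c′ (trans (Fin.punchOut-cong p refl) (Fin.punchOut-punchIn p))
  split : ∀ j → sumℚ (λ i → c i *ℚ M i j) ≡ - sumℚ t *ℚ M p j +ℚ sumℚ (λ i → c′ i *ℚ M (punchIn p i) j)
  split j = trans (sumℚ-remove p (λ i → c i *ℚ M i j))
    (cong₂ _+ℚ_ (cong (_*ℚ M p j) c-pivot) (sumℚ-cong {k} λ i → cong (_*ℚ M (punchIn p i) j) (c-punchIn i)))
  negate : ∀ a b → - a *ℚ b ≡ (- 1ℚ) *ℚ (a *ℚ b)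
  negate = solve 2 (λ a b → :- a :* b := con (- 1ℚ) :* (a :* b)) refl
  rearrange : ∀ c a q b d → (- 1ℚ) *ℚ (c *ℚ (a *ℚ q) *ℚ b) +ℚ c *ℚ d ≡ c *ℚ (d +ℚ - (a *ℚ q *ℚ b))
  rearrange = solve 5 (λ c a q b d → con (- 1ℚ) :* (c :* (a :* q) :* b) :+ c :* d := c :* (d :+ :- (a :* q :* b))) refl
  pivot-column : ∀ c a → c *ℚ a ≡ c *ℚ (a *ℚ q) *ℚ M p zero
  pivot-column c a = begin
    c *ℚ a                          ≡⟨ ℚ.*-identityʳ (c *ℚ a) ⟨
    c *ℚ a *ℚ 1ℚ                    ≡⟨ cong (c *ℚ a *ℚ_) (ℚ.*-inverseˡ (M p zero)) ⟨
    c *ℚ a *ℚ (q *ℚ M p zero)       ≡⟨ reassoc c a q (M p zero) ⟩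
    c *ℚ (a *ℚ q) *ℚ M p zero       ∎
    where
    reassoc : ∀ c a q m → c *ℚ a *ℚ (q *ℚ m) ≡ c *ℚ (a *ℚ q) *ℚ m
    reassoc = solve 4 (λ c a q m → c :* a :* (q :* m) := c :* (a :* q) :* m) refl
  cancel : ∀ j → - sumℚ t *ℚ M p j +ℚ sumℚ (λ i → t i *ℚ M p j) ≡ 0ℚ
  cancel j = trans (cong (- sumℚ t *ℚ M p j +ℚ_) (sumℚ-*ʳ (M p j) t)) (zeroSum (sumℚ t) (M p j))
    where
    zeroSum : ∀ a b → - a *ℚ b +ℚ a *ℚ b ≡ 0ℚ
    zeroSum = solve 2 (λ a b → :- a :* b :+ a :* b := con 0ℚ) refl

-- Kernel vectors determined by their values at few vertices

combination : ∀ {n k} → (Fin k → ℚ) → (Fin k → Fin n → ℚ) → Fin n → ℚ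
combination c v j = sumℚ (λ i → c i *ℚ v i j)

-- By linearity this is injectivity of the evaluation map that sends a kernel vector to its values
-- on `s`.
Determines : ∀ {n m} → SignedGraph n → (Fin m → Fin n) → Set
Determines G s = ∀ x → InKernel G x → (∀ i → x (s i) ≡ 0ℚ) → ∀ j → x j ≡ 0ℚ

module _ {n} (G : SignedGraph n) where

  combination-InKernel : ∀ {k} (c : Fin k → ℚ) {v : Fin k → Fin n → ℚ} → (∀ i → InKernel G (v i)) → InKernel G (combination c v)
  combination-InKernel {k} c {v} ker i = begin
    sumℚ (λ j → A G i j *ℚ sumℚ (λ l → c l *ℚ v l j))  ≡⟨ sumℚ-cong {n} (λ j → sumℚ-*ˡ (A G i j) (λ l → c l *ℚ v l j)) ⟨
    sumℚ (λ j → sumℚ (λ l → A G i j *ℚ (c l *ℚ v l j))) ≡⟨ sumℚ-swap (λ j l → A G i j *ℚ (c l *ℚ v l j)) ⟩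
    sumℚ (λ l → sumℚ (λ j → A G i j *ℚ (c l *ℚ v l j))) ≡⟨ sumℚ-cong {k} (λ l → sumℚ-cong {n} λ j → commute (A G i j) (c l) (v l j)) ⟩
    sumℚ (λ l → sumℚ (λ j → c l *ℚ (A G i j *ℚ v l j))) ≡⟨ sumℚ-cong {k} (λ l → sumℚ-*ˡ (c l) (λ j → A G i j *ℚ v l j)) ⟩
    sumℚ (λ l → c l *ℚ sumℚ (λ j → A G i j *ℚ v l j))   ≡⟨ sumℚ-zero (λ l → trans (cong (c l *ℚ_) (ker l i)) (ℚ.*-zeroʳ (c l))) ⟩
    0ℚ ∎
    where
    open ≡-Reasoning
    commute : ∀ a b c → a *ℚ (b *ℚ c) ≡ b *ℚ (a *ℚ c)
    commute = solve 3 (λ a b c → a :* (b :* c) := b :* (a :* c)) refl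

  module _ {m k} (s : Fin m → Fin n) (det : Determines G s)
           (v : Fin k → Fin n → ℚ) (ker : ∀ i → InKernel G (v i)) (indep : LinIndep v) where

    -- The combination lies in the kernel, so vanishing on `s` makes it vanish everywhere, and
    -- independence applies.
    relation-trivial : ∀ c → (∀ j → sumℚ (λ i → c i *ℚ v i (s j)) ≡ 0ℚ) → ∀ i → c i ≡ 0ℚ
    relation-trivial c rel = indep c (det (combination c v) (combination-InKernel c ker) rel)

    indep-size≤ : k ≤ m
    indep-size≤ with k ℕ.≤? m
    ... | yes p = p
    ... | no ¬p with nontrivial-relation m (ℕ.≰⇒> ¬p) (λ i j → v i (s j))
    ...   | c , (i , ci≢0) , rel = contradiction (relation-trivial c rel i) ci≢0

    -- Counterpart of `indep-size≤`: with `m` or more independent kernel vectors, evaluation on `s`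
    -- is also surjective.
    interpolate : m ≤ k → (b : Fin m → ℚ) → ∃ λ x → InKernel G x × (∀ j → x (s j) ≡ b j)
    interpolate m≤k b = combination d v , combination-InKernel d ker , values
      where
      open ≡-Reasoning
      -- The target values form an extra row: `suc k` rows in `m ≤ k` columns are dependent.
      M : Fin (suc k) → Fin m → ℚ
      M zero j = b j
      M (suc i) j = v i (s j)
      rel = nontrivial-relation m (s≤s m≤k) M
      c : Fin (suc k) → ℚ
      c = proj₁ rel
      sumRest : Fin m → ℚ
      sumRest = λ j → sumℚ (λ i → c (suc i) *ℚ v i (s j))
      -- Otherwise the values of `v` on `s` alone would be dependent. Dividing by this coefficient
      -- then solves the relation for `b`.
      c₀≢0 : c zero ≢ 0ℚ
      c₀≢0 e with proj₁ (proj₂ rel)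
      ... | zero , c₀≢ = c₀≢ e
      ... | suc i , ci≢0 = ci≢0 (relation-trivial (c ∘ suc) rest i)
        where
        rest : ∀ j → sumRest j ≡ 0ℚ
        rest j = begin
          sumRest j                       ≡⟨ ℚ.+-identityˡ (sumRest j) ⟨
          0ℚ +ℚ sumRest j                 ≡⟨ cong (_+ℚ sumRest j) (ℚ.*-zeroˡ (b j)) ⟨
          0ℚ *ℚ b j +ℚ sumRest j          ≡⟨ cong (λ z → z *ℚ b j +ℚ sumRest j) e ⟨
          c zero *ℚ b j +ℚ sumRest j      ≡⟨ proj₂ (proj₂ rel) j ⟩
          0ℚ                              ∎
      instance _ = ≢-nonZero c₀≢0
      r = 1/ (c zero)
      d : Fin k → ℚ
      d i = - r *ℚ c (suc i)
      values : ∀ j → combination d v (s j) ≡ b j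
      values j = begin
        sumℚ (λ i → - r *ℚ c (suc i) *ℚ v i (s j))     ≡⟨ sumℚ-cong {k} (λ i → ℚ.*-assoc (- r) (c (suc i)) (v i (s j))) ⟩
        sumℚ (λ i → - r *ℚ (c (suc i) *ℚ v i (s j)))   ≡⟨ sumℚ-*ˡ (- r) (λ i → c (suc i) *ℚ v i (s j)) ⟩
        - r *ℚ sumRest j                               ≡⟨ shift r (sumRest j) (c zero) (b j) ⟩
        r *ℚ c zero *ℚ b j +ℚ - r *ℚ (c zero *ℚ b j +ℚ sumRest j) ≡⟨ cong₂ (λ y z → y *ℚ b j +ℚ - r *ℚ z) (ℚ.*-inverseˡ (c zero)) (proj₂ (proj₂ rel) j) ⟩
        1ℚ *ℚ b j +ℚ - r *ℚ 0ℚ                         ≡⟨ cong₂ _+ℚ_ (ℚ.*-identityˡ (b j)) (ℚ.*-zeroʳ (- r)) ⟩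
        b j +ℚ 0ℚ                                      ≡⟨ ℚ.+-identityʳ (b j) ⟩
        b j                                            ∎
        where
        shift : ∀ r s c b → - r *ℚ s ≡ r *ℚ c *ℚ b +ℚ - r *ℚ (c *ℚ b +ℚ s)
        shift = solve 4 (λ r s c b → :- r :* s := r :* c :* b :+ :- r :* (c :* b :+ s)) refl

-- Counting vertices, edges and components

sum-map-++ : ∀ {a} {X : Set a} (f : X → ℕ) xs ys → sum (map f (xs ++ ys)) ≡ sum (map f xs) + sum (map f ys)
sum-map-++ f [] ys = refl
sum-map-++ f (x ∷ xs) ys = trans (cong (f x +_) (sum-map-++ f xs ys)) (≡.sym (ℕ.+-assoc (f x) _ _))

-- Each entry of `xs` is cut out of `ys` in turn; uniqueness of `xs` keeps the later entries in what
-- is left.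
sum-map-⊆ : ∀ {a} {X : Set a} (f : X → ℕ) {xs ys : List X} → Unique xs →
  (∀ {x} → x ∈ xs → x ∈ ys) → sum (map f xs) ≤ sum (map f ys)
sum-map-⊆ f {[]} [] _ = z≤n
sum-map-⊆ f {x ∷ xs} {ys} (x∉ ∷ u) sub with ∈-∃++ (sub (here refl))
... | as , bs , refl = begin
  f x + sum (map f xs)                           ≤⟨ ℕ.+-monoʳ-≤ (f x) (sum-map-⊆ f u sub′) ⟩
  f x + sum (map f (as ++ bs))                   ≡⟨ cong (f x +_) (sum-map-++ f as bs) ⟩
  f x + (sum (map f as) + sum (map f bs))        ≡⟨ swap (f x) (sum (map f as)) (sum (map f bs)) ⟩
  sum (map f as) + (f x + sum (map f bs))        ≡⟨ sum-map-++ f as (x ∷ bs) ⟨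
  sum (map f (as ++ x ∷ bs))                     ∎
  where
  open ℕ.≤-Reasoning
  swap : ∀ a b c → a + (b + c) ≡ b + (a + c)
  swap = solve-∀
  sub′ : ∀ {y} → y ∈ xs → y ∈ as ++ bs
  sub′ y∈ with ∈-++⁻ as (sub (there y∈))
  ... | inj₁ p = ∈-++⁺ˡ p
  ... | inj₂ (here refl) = contradiction refl (All.lookup x∉ y∈)
  ... | inj₂ (there p) = ∈-++⁺ʳ as p

length≡sum : ∀ {a} {X : Set a} (xs : List X) → length xs ≡ sum (map (λ _ → 1) xs)
length≡sum [] = refl
length≡sum (x ∷ xs) = cong suc (length≡sum xs)

length-⊆ : ∀ {a} {X : Set a} {xs ys : List X} → Unique xs →
  (∀ {x} → x ∈ xs → x ∈ ys) → length xs ≤ length ys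
length-⊆ {xs = xs} {ys} u sub = ≡.subst₂ _≤_ (≡.sym (length≡sum xs)) (≡.sym (length≡sum ys)) (sum-map-⊆ (λ _ → 1) u sub)

unique-length≤n : ∀ {n} {xs : List (Fin n)} → Unique xs → length xs ≤ n
unique-length≤n {n} {xs} u = subst (length xs ≤_) (length-tabulate {n = n} id) (length-⊆ u (λ _ → ∈-allFin _))

∷-unique : ∀ {a} {X : Set a} {x : X} {xs} → x ∉ xs → Unique xs → Unique (x ∷ xs)
∷-unique x∉ u = ¬Any⇒All¬ _ x∉ ∷ u

select : ∀ {n} → (Fin n → Bool) → List (Fin n)
select {n} p = filter (T? ∘ p) (allFin n)

∈-select⁺ : ∀ {n} (p : Fin n → Bool) {i} → T (p i) → i ∈ select p
∈-select⁺ p t = ∈-filter⁺ (T? ∘ p) (∈-allFin _) t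

∈-select⁻ : ∀ {n} (p : Fin n → Bool) {i} → i ∈ select p → T (p i)
∈-select⁻ p i∈ = proj₂ (∈-filter⁻ (T? ∘ p) {xs = allFin _} i∈)

select-unique : ∀ {n} (p : Fin n → Bool) → Unique (select p)
select-unique {n} p = Unique.filter⁺ (T? ∘ p) (Unique.allFin⁺ n)

countB≡length-select : ∀ {n} (p : Fin n → Bool) → countB p ≡ length (select p)
countB≡length-select {n} p = go (allFin n)
  where
  go : ∀ xs → sum (map (λ i → if p i then 1 else 0) xs) ≡ length (filter (T? ∘ p) xs)
  go [] = refl
  go (x ∷ xs) with p x
  ... | true = cong suc (go xs)
  ... | false = go xs

sum-allFin : ∀ {n} (f : Fin n → ℕ) → sum (map f (allFin n)) ≡ Σℕ.sum f
sum-allFin {n} f = trans (cong sum (map-tabulate id f)) (go f)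
  where
  go : ∀ {m} (g : Fin m → ℕ) → sum (tabulate g) ≡ Σℕ.sum g
  go {zero} g = refl
  go {suc m} g = cong (g zero +_) (go (g ∘ suc))

sum-allFin-+ : ∀ {n} (f g : Fin n → ℕ) →
  sum (map (λ i → f i + g i) (allFin n)) ≡ sum (map f (allFin n)) + sum (map g (allFin n))
sum-allFin-+ f g = trans (sum-allFin (λ i → f i + g i))
  (trans (Σℕ.∑-distrib-+ f g) (≡.sym (cong₂ _+_ (sum-allFin f) (sum-allFin g))))

sum-allFin-cong : ∀ {n} {f g : Fin n → ℕ} → (∀ i → f i ≡ g i) →
  sum (map f (allFin n)) ≡ sum (map g (allFin n))
sum-allFin-cong {f = f} {g} e = trans (sum-allFin f) (trans (Σℕ.sum-cong-≗ e) (≡.sym (sum-allFin g)))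

sum-allFin-swap : ∀ {m n} (f : Fin m → Fin n → ℕ) →
  sum (map (λ i → sum (map (f i) (allFin n))) (allFin m)) ≡
  sum (map (λ j → sum (map (λ i → f i j) (allFin m))) (allFin n))
sum-allFin-swap {m} {n} f = begin
  sum (map (λ i → sum (map (f i) (allFin n))) (allFin m))  ≡⟨ sum-allFin-cong (λ i → sum-allFin (f i)) ⟩
  sum (map (λ i → Σℕ.sum (f i)) (allFin m))                     ≡⟨ sum-allFin (λ i → Σℕ.sum (f i)) ⟩
  Σℕ.sum (λ i → Σℕ.sum (f i))                                        ≡⟨ Σℕ.∑-comm f ⟩
  Σℕ.sum (λ j → Σℕ.sum (λ i → f i j))                                ≡⟨ sum-allFin (λ j → Σℕ.sum (λ i → f i j)) ⟨
  sum (map (λ j → Σℕ.sum (λ i → f i j)) (allFin n))             ≡⟨ sum-allFin-cong (λ j → sum-allFin (λ i → f i j)) ⟨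
  sum (map (λ j → sum (map (λ i → f i j) (allFin m))) (allFin n)) ∎
  where open ≡-Reasoning

sum-allFin-const : ∀ n c → sum (map (λ _ → c) (allFin n)) ≡ n * c
sum-allFin-const n c = trans (go (allFin n)) (cong (_* c) (length-tabulate {n = n} id))
  where
  go : ∀ {a} {X : Set a} (xs : List X) → sum (map (λ _ → c) xs) ≡ length xs * c
  go [] = refl
  go (x ∷ xs) = cong (c +_) (go xs)

module _ {n} (G : SignedGraph n) where

  Adj : Fin n → Fin n → Set
  Adj i j = T (adj G i j)

  Adj-sym : ∀ {i j} → Adj i j → Adj j i
  Adj-sym {i} {j} = subst (T ∘ is-just) (sym G i j)

  Adj-irrefl : ∀ {i} → ¬ Adj i i
  Adj-irrefl {i} a = subst (T ∘ is-just) (irrefl G i) a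

  Adj⇒≢ : ∀ {i j} → Adj i j → i ≢ j
  Adj⇒≢ a refl = Adj-irrefl a

  A-sym : ∀ i j → A G i j ≡ A G j i
  A-sym i j = cong entry (sym G i j)

  Adj⇒A≢0 : ∀ {i j} → Adj i j → A G i j ≢ 0ℚ
  Adj⇒A≢0 {i} {j} a with w G i j
  ... | just Sign.+ = λ ()
  ... | just Sign.- = λ ()

  ¬Adj⇒A≡0 : ∀ {i j} → ¬ Adj i j → A G i j ≡ 0ℚ
  ¬Adj⇒A≡0 {i} {j} ¬a with w G i j
  ... | just _ = contradiction tt ¬a
  ... | nothing = refl

  nbrs : Fin n → List (Fin n)
  nbrs i = select (adj G i)

  degree≡length : ∀ i → degree G i ≡ length (nbrs i)
  degree≡length i = countB≡length-select (adj G i)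

  length≤degree : ∀ {i xs} → Unique xs → (∀ {j} → j ∈ xs → Adj i j) → length xs ≤ degree G i
  length≤degree {i} {xs} u sub = subst (length xs ≤_) (≡.sym (degree≡length i)) (length-⊆ u (∈-select⁺ (adj G i) ∘ sub))

  -- Walks and reachability

  walk-step : ∀ k {i l j} → T (walkB G k i l) → Adj l j → T (walkB G (suc k) i j)
  walk-step k {i} {l} {j} wl a = Equivalence.from T-∨
    (inj₂ (any⁺ _ (lose (∈-allFin l) (Equivalence.from T-∧ (wl , a)))))

  walk-unstep : ∀ k {i j} → T (walkB G (suc k) i j) →
    T (walkB G k i j) ⊎ ∃ λ l → T (walkB G k i l) × Adj l j
  walk-unstep k {i} {j} wj with Equivalence.to (T-∨ {walkB G k i j}) wj
  ... | inj₁ p = inj₁ p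
  ... | inj₂ p with find (any⁻ _ (allFin n) p)
  ...   | l , _ , q = inj₂ (l , Equivalence.to T-∧ q)

  walk⇒Star : ∀ k {i j} → T (walkB G k i j) → Star Adj i j
  walk⇒Star zero {i} {j} t with refl ← toWitness {a? = i ≟ j} t = ε
  walk⇒Star (suc k) t with walk-unstep k t
  ... | inj₁ p = walk⇒Star k p
  ... | inj₂ (l , p , a) = walk⇒Star k p ◅◅ (a ◅ ε)

  walk-refl : ∀ k i → T (walkB G k i i)
  walk-refl zero i = fromWitness {a? = i ≟ i} refl
  walk-refl (suc k) i = Equivalence.from T-∨ (inj₁ (walk-refl k i))

  Saturated : ℕ → Fin n → Set
  Saturated k i = ∀ {l j} → T (walkB G k i l) → Adj l j → T (walkB G k i j)

  -- Until the sets of vertices within distance k of i stabilise, each is larger than the previous one.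
  saturated-or-large : ∀ k i → Saturated k i ⊎ k < length (select (walkB G k i))
  saturated-or-large zero i = inj₂ (length-⊆ {xs = i ∷ []} ([] ∷ []) λ { (here refl) → ∈-select⁺ (walkB G 0 i) (walk-refl 0 i) })
  saturated-or-large (suc k) i with saturated-or-large k i
  ... | inj₁ sat = inj₁ λ p a → Equivalence.from T-∨ (inj₁ (sat (back p) a))
    where
    back : ∀ {l} → T (walkB G (suc k) i l) → T (walkB G k i l)
    back p with walk-unstep k p
    ... | inj₁ q = q
    ... | inj₂ (l , q , a) = sat q a
  ... | inj₂ large with Fin.any? (λ j → T? (walkB G (suc k) i j) ×-dec ¬? (T? (walkB G k i j)))
  ...   | yes (j , new , ¬old) = inj₂ (ℕ.≤-trans (s≤s large) (length-⊆
            (∷-unique (λ j∈ → ¬old (∈-select⁻ (walkB G k i) j∈)) (select-unique (walkB G k i)))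
            λ { (here refl) → ∈-select⁺ (walkB G (suc k) i) new
              ; (there p) → ∈-select⁺ (walkB G (suc k) i) (Equivalence.from T-∨ (inj₁ (∈-select⁻ (walkB G k i) p))) }))
  ...   | no none = inj₁ λ p a → Equivalence.from T-∨ (inj₁ (back (walk-step k (back p) a)))
    where
    back : ∀ {l} → T (walkB G (suc k) i l) → T (walkB G k i l)
    back {l} p = decidable-stable (T? (walkB G k i l)) (λ ¬old → none (l , p , ¬old))

  -- `Reach` only looks at walks of at most `n` steps. More than `n` distinct vertices cannot occur,
  -- so `saturated-or-large` leaves the saturated case: longer walks reach nothing new.
  Reach-step : ∀ {i l j} → Reach G i l → Adj l j → Reach G i j
  Reach-step {i} with saturated-or-large n i
  ... | inj₁ sat = sat
  ... | inj₂ large = contradiction (unique-length≤n (select-unique (walkB G n i))) (ℕ.<⇒≱ large)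

  Reach-refl : ∀ {i} → Reach G i i
  Reach-refl {i} = walk-refl n i

  Reach-Star : ∀ {i l j} → Reach G i l → Star Adj l j → Reach G i j
  Reach-Star r ε = r
  Reach-Star r (a ◅ s) = Reach-Star (Reach-step r a) s

  Reach-trans : ∀ {i l j} → Reach G i l → Reach G l j → Reach G i j
  Reach-trans r s = Reach-Star r (walk⇒Star n s)

  Reach-sym : ∀ {i j} → Reach G i j → Reach G j i
  Reach-sym r = Reach-Star Reach-refl (reverse Adj-sym (walk⇒Star n r))

  Reach? : ∀ i j → Dec (Reach G i j)
  Reach? i j = T? (walkB G n i j)

  closed⇒Reach : ∀ {p} (P : Fin n → Set p) → (∀ {i j} → P i → Adj i j → P j) → ∀ {i j} → P i → Reach G i j → P j
  closed⇒Reach P step p r = go p (walk⇒Star n r)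
    where
    go : ∀ {i j} → P i → Star Adj i j → P j
    go p ε = p
    go p (a ◅ s) = go (step p a) s

  ∃-neighbour : ∀ {u v} → u ≢ v → Reach G v u → ∃ λ j → Adj v j
  ∃-neighbour u≢v r with walk⇒Star n r
  ... | ε = contradiction refl u≢v
  ... | a ◅ _ = _ , a

  -- Components and their least vertices

  isLeast : Fin n → Bool
  isLeast i = not (any (λ j → (toℕ j <ᵇ toℕ i) ∧ walkB G n i j) (allFin n))

  isLeast⁻ : ∀ {i j} → T (isLeast i) → Reach G i j → toℕ i ≤ toℕ j
  isLeast⁻ {i} {j} l r = ℕ.≮⇒≥ λ j<i → ¬T-both l (any⁺ _ (lose (∈-allFin j) (Equivalence.from T-∧ (ℕ.<⇒<ᵇ j<i , r))))
    where
    ¬T-both : ∀ {b} → T (not b) → ¬ T b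
    ¬T-both {false} _ ()

  isLeast⁺ : ∀ {i} → (∀ {j} → Reach G i j → toℕ i ≤ toℕ j) → T (isLeast i)
  isLeast⁺ {i} least = ¬T⇒T-not λ t → case find (any⁻ _ (allFin n) t) of λ
    { (j , _ , q) → let j<i , r = Equivalence.to T-∧ q in ℕ.<⇒≱ (ℕ.<ᵇ⇒< (toℕ j) (toℕ i) j<i) (least r) }
    where
    ¬T⇒T-not : ∀ {b} → ¬ T b → T (not b)
    ¬T⇒T-not {false} _ = tt
    ¬T⇒T-not {true} ¬t = ¬t tt

  representative : ∀ i → ∃ λ r → Reach G i r × T (isLeast r)
  representative i = go i (<-wellFounded i)
    where
    go : ∀ i → Acc Fin._<_ i → ∃ λ r → Reach G i r × T (isLeast r)
    go i (acc rec) with Fin.any? (λ j → (toℕ j ℕ.<? toℕ i) ×-dec Reach? i j)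
    ... | yes (j , j<i , r) with go j (rec j<i)
    ...   | k , s , l = k , Reach-trans r s , l
    go i (acc rec) | no none = i , Reach-refl , isLeast⁺ (λ {j} r → ℕ.≮⇒≥ λ j<i → none (j , j<i , r))

  isLeast-unique : ∀ {i j} → T (isLeast i) → T (isLeast j) → Reach G i j → i ≡ j
  isLeast-unique li lj r = Fin.toℕ-injective (ℕ.≤-antisym (isLeast⁻ li r) (isLeast⁻ lj (Reach-sym r)))

  components≡length : components G ≡ length (select isLeast)
  components≡length = countB≡length-select isLeast

  -- Sending each vertex to the least one in its component is injective on vertices that are
  -- pairwise unreachable.
  length≤components : ∀ {R} → AllPairs (λ r s → ¬ Reach G r s) R → length R ≤ components G
  length≤components {R} apart = begin
    length R                                ≡⟨ length-map rep R ⟨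
    length (map rep R)                      ≤⟨ length-⊆ distinct least ⟩
    length (select isLeast)                 ≡⟨ components≡length ⟨
    components G                            ∎
    where
    open ℕ.≤-Reasoning
    rep : Fin n → Fin n
    rep i = proj₁ (representative i)
    same : ∀ {r s} → rep r ≡ rep s → Reach G r s
    same {r} {s} e = Reach-trans (proj₁ (proj₂ (representative r)))
      (subst (λ z → Reach G z s) (≡.sym e) (Reach-sym (proj₁ (proj₂ (representative s)))))
    distinct : Unique (map rep R)
    distinct = AllPairs.map⁺ (AllPairs.map (λ ¬r e → ¬r (same e)) apart)
    least : ∀ {x} → x ∈ map rep R → x ∈ select isLeast
    least x∈ with ∈-map⁻ rep x∈
    ... | i , _ , refl = ∈-select⁺ isLeast (proj₂ (proj₂ (representative i)))

  -- Degree sums and the value of 2c + p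

  excess : ℕ
  excess = sum (map (λ i → degree G i ∸ 2) (allFin n))

  -- Every ordered adjacent pair is sorted by which end is smaller; exchanging the two summations
  -- shows that both halves count the edges.
  handshake : sum (map (degree G) (allFin n)) ≡ numEdges G + numEdges G
  handshake = begin
    sum (map (degree G) (allFin n))
      ≡⟨ sum-allFin-cong (λ i → sum-allFin-cong (split i)) ⟩
    sum (map (λ i → sum (map (λ j → a i j + a j i) (allFin n))) (allFin n))
      ≡⟨ sum-allFin-cong (λ i → sum-allFin-+ (a i) (λ j → a j i)) ⟩
    sum (map (λ i → sum (map (a i) (allFin n)) + sum (map (λ j → a j i) (allFin n))) (allFin n))
      ≡⟨ sum-allFin-+ (λ i → sum (map (a i) (allFin n))) (λ i → sum (map (λ j → a j i) (allFin n))) ⟩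
    numEdges G + sum (map (λ i → sum (map (λ j → a j i) (allFin n))) (allFin n))
      ≡⟨ cong (numEdges G +_) (sum-allFin-swap a) ⟨
    numEdges G + numEdges G ∎
    where
    open ≡-Reasoning
    a : Fin n → Fin n → ℕ
    a i j = if (toℕ i <ᵇ toℕ j) ∧ adj G i j then 1 else 0
    split : ∀ i j → (if adj G i j then 1 else 0) ≡ a i j + a j i
    split i j rewrite sym G j i with adj G i j in eq
    ... | false = cong₂ (λ b c → (if b then 1 else 0) + (if c then 1 else 0)) (≡.sym (∧-false (toℕ i <ᵇ toℕ j))) (≡.sym (∧-false (toℕ j <ᵇ toℕ i)))
      where
      ∧-false : ∀ b → b ∧ false ≡ false
      ∧-false false = refl
      ∧-false true = refl
    ... | true with toℕ i <ᵇ toℕ j in p | toℕ j <ᵇ toℕ i in q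
    ...   | true  | false = refl
    ...   | false | true  = refl
    ...   | true  | true  = contradiction (ℕ.<ᵇ⇒< (toℕ i) (toℕ j) (Equivalence.from T-≡ p)) (ℕ.<-asym (ℕ.<ᵇ⇒< (toℕ j) (toℕ i) (Equivalence.from T-≡ q)))
    ...   | false | false = contradiction
      (Fin.toℕ-injective (ℕ.≤-antisym (ℕ.≮⇒≥ λ h → subst T q (ℕ.<⇒<ᵇ h)) (ℕ.≮⇒≥ λ h → subst T p (ℕ.<⇒<ᵇ h))))
      (Adj⇒≢ (Equivalence.from T-≡ eq))

  -- Summing the identity d + [d = 1] = 2 + (d ∸ 2), valid for d ≥ 1, over all degrees. A pendant
  -- vertex compensates for the truncation.
  degree-balance : (∀ i → 1 ≤ degree G i) → numEdges G + numEdges G + pendant G ≡ n * 2 + excess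
  degree-balance pos = begin
    numEdges G + numEdges G + pendant G              ≡⟨ cong (_+ pendant G) handshake ⟨
    sum (map (degree G) (allFin n)) + pendant G      ≡⟨ sum-allFin-+ (degree G) (λ i → if ⌊ degree G i ℕ.≟ 1 ⌋ then 1 else 0) ⟨
    sum (map (λ i → degree G i + (if ⌊ degree G i ℕ.≟ 1 ⌋ then 1 else 0)) (allFin n))
      ≡⟨ sum-allFin-cong (λ i → pointwise (degree G i) (pos i)) ⟩
    sum (map (λ i → 2 + (degree G i ∸ 2)) (allFin n)) ≡⟨ sum-allFin-+ (λ _ → 2) (λ i → degree G i ∸ 2) ⟩
    sum (map (λ _ → 2) (allFin n)) + excess          ≡⟨ cong (_+ excess) (sum-allFin-const n 2) ⟩
    n * 2 + excess                                   ∎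
    where
    open ≡-Reasoning
    pointwise : ∀ d → 1 ≤ d → d + (if ⌊ d ℕ.≟ 1 ⌋ then 1 else 0) ≡ 2 + (d ∸ 2)
    pointwise 1 _ = refl
    pointwise (suc (suc d)) _ = ℕ.+-identityʳ _

  -- This direction shows that a nullity of 2c + p is large enough for `Extremal`. It rests on
  -- `e + ω ≤ n + (e + ω ∸ n)`, which holds for truncated subtraction.
  bound≤2c+p : (∀ i → 1 ≤ degree G i) → 2 * components G + excess ≤ 2 * cyclomatic G + pendant G
  bound≤2c+p pos = ℕ.+-cancelˡ-≤ (n * 2) _ _ (begin
    n * 2 + (2 * ω + excess)           ≡⟨ left n ω excess ⟩
    2 * ω + (n * 2 + excess)           ≡⟨ cong (2 * ω +_) (degree-balance pos) ⟨
    2 * ω + (e + e + pendant G)        ≡⟨ middle ω e (pendant G) ⟩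
    2 * (e + ω) + pendant G            ≤⟨ ℕ.+-monoˡ-≤ (pendant G) (ℕ.*-monoʳ-≤ 2 (ℕ.m≤n+m∸n (e + ω) n)) ⟩
    2 * (n + (e + ω ∸ n)) + pendant G  ≡⟨ right n (e + ω ∸ n) (pendant G) ⟩
    n * 2 + (2 * (e + ω ∸ n) + pendant G) ∎)
    where
    open ℕ.≤-Reasoning
    ω = components G
    e = numEdges G
    left : ∀ n w x → n * 2 + (2 * w + x) ≡ 2 * w + (n * 2 + x)
    left = solve-∀
    middle : ∀ w e p → 2 * w + (e + e + p) ≡ 2 * (e + w) + p
    middle = solve-∀
    right : ∀ n c p → 2 * (n + c) + p ≡ n * 2 + (2 * c + p)
    right = solve-∀

  module _ (deg2 : ∀ i → degree G i ≡ 2) where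

    excess≡0 : excess ≡ 0
    excess≡0 = trans (sum-allFin-cong (λ i → cong (_∸ 2) (deg2 i))) (trans (sum-allFin-const n 0) (ℕ.*-zeroʳ n))

    -- `degree-balance` gives as many edges as vertices, so the subtraction in `cyclomatic` leaves
    -- exactly the number of components.
    2-regular⇒2c+p : 2 * cyclomatic G + pendant G ≡ 2 * components G
    2-regular⇒2c+p = begin
      2 * (numEdges G + components G ∸ n) + pendant G  ≡⟨ cong₂ (λ e p → 2 * (e + components G ∸ n) + p) edges pendant≡0 ⟩
      2 * (n + components G ∸ n) + 0                   ≡⟨ ℕ.+-identityʳ _ ⟩
      2 * (n + components G ∸ n)                       ≡⟨ cong (2 *_) (ℕ.m+n∸m≡n n (components G)) ⟩
      2 * components G                                 ∎
      where
      open ≡-Reasoning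
      pendant≡0 : pendant G ≡ 0
      pendant≡0 = trans (sum-allFin-cong (λ i → cong (λ d → if ⌊ d ℕ.≟ 1 ⌋ then 1 else 0) (deg2 i)))
        (trans (sum-allFin-const n 0) (ℕ.*-zeroʳ n))
      double : ∀ e → e + e + 0 ≡ e * 2
      double = solve-∀
      edges : numEdges G ≡ n
      edges = ℕ.*-cancelʳ-≡ _ _ 2 (begin
        numEdges G * 2                       ≡⟨ double (numEdges G) ⟨
        numEdges G + numEdges G + 0          ≡⟨ cong (numEdges G + numEdges G +_) pendant≡0 ⟨
        numEdges G + numEdges G + pendant G  ≡⟨ degree-balance (λ i → subst (1 ≤_) (≡.sym (deg2 i)) (s≤s z≤n)) ⟩
        n * 2 + excess                       ≡⟨ cong (n * 2 +_) excess≡0 ⟩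
        n * 2 + 0                            ≡⟨ ℕ.+-identityʳ (n * 2) ⟩
        n * 2                                ∎)

-- Zero forcing

_∈?_ : ∀ {n} (i : Fin n) xs → Dec (i ∈ xs)
_∈?_ = DecMembership._∈?_ _≟_

row : ∀ {n} → SignedGraph n → (Fin n → ℚ) → Fin n → ℚ
row G x i = sumℚ (λ j → A G i j *ℚ x j)

module _ {n} (G : SignedGraph n) where

  A*-zero : ∀ (x : Fin n → ℚ) {i j} → (Adj G i j → x j ≡ 0ℚ) → A G i j *ℚ x j ≡ 0ℚ
  A*-zero x {i} {j} h with T? (adj G i j)
  ... | yes a = trans (cong (A G i j *ℚ_) (h a)) (ℚ.*-zeroʳ (A G i j))
  ... | no ¬a = trans (cong (_*ℚ x j) (¬Adj⇒A≡0 G ¬a)) (ℚ.*-zeroˡ (x j))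

  -- Only the term of `o` survives in the equation of `p`, and its coefficient is a sign.
  forced : ∀ (x : Fin n → ℚ) {p o} → Adj G p o → row G x p ≡ 0ℚ →
    (∀ {j} → Adj G p j → j ≢ o → x j ≡ 0ℚ) → x o ≡ 0ℚ
  forced x {p} {o} a eq rest = *-nonzero-cancel (Adj⇒A≢0 G a)
    (trans (≡.sym (sumℚ-single o (λ j → A G p j *ℚ x j) (λ j j≢o → A*-zero x (λ b → rest b j≢o)))) eq)

  excessOf : Fin n → ℕ
  excessOf i = degree G i ∸ 2

  -- A stage of a zero forcing process.  A vector that vanishes on the chosen vertices base ++ free and
  -- satisfies the equations of the processed vertices vanishes on all reached vertices.
  -- Each root accounts for two chosen vertices, each processed vertex i for degree i ∸ 2 of them.
  record Stage (base roots : List (Fin n)) (slack : ℕ) : Set where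
    field
      free reached processed : List (Fin n)
      determined : ∀ x → (∀ {i} → i ∈ processed → row G x i ≡ 0ℚ) →
        (∀ {i} → i ∈ base ++ free → x i ≡ 0ℚ) → ∀ {i} → i ∈ reached → x i ≡ 0ℚ
      base⊆reached : ∀ {i} → i ∈ base → i ∈ reached
      roots⊆reached : ∀ {i} → i ∈ roots → i ∈ reached
      processed⊆reached : ∀ {i} → i ∈ processed → i ∈ reached
      attached : ∀ {i} → i ∈ reached → ∃ λ j → j ∈ reached × Adj G i j
      closed : ∀ {i j} → i ∈ processed → Adj G i j → j ∈ reached
      unique : Unique processed
      apart : AllPairs (λ r s → ¬ Reach G r s) roots
      -- `slack` is a guaranteed surplus of the budget on the right over the number of chosen
      -- vertices.
      size : length base + length free + slack ≤ 2 * length roots + sum (map excessOf processed)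
  open Stage

  module _ {base roots : List (Fin n)} {slack : ℕ} (st : Stage base roots slack) where

    -- All but one of the unreached neighbours of p are chosen; the equation of p forces the last one.
    process : ∀ {p} → p ∈ reached st → p ∉ processed st → ∀ known gain →
      Unique known → (∀ {i} → i ∈ known → i ∈ reached st × Adj G p i) →
      suc gain ≤ length known → gain ≤ excessOf p →
      Σ (Stage base roots (slack + gain)) λ st′ → processed st′ ≡ p ∷ processed st
    process {p} p∈ p∉ known gain uK known-ok gain< gain≤ = result new refl
      where
      new? = λ j → T? (adj G p j) ×-dec ¬? (j ∈? reached st)
      new = filter new? (allFin n)
      new⁻ : ∀ {j} → j ∈ new → Adj G p j × j ∉ reached st
      new⁻ j∈ = proj₂ (∈-filter⁻ new? {xs = allFin n} j∈)
      new⁺ : ∀ {j} → Adj G p j → j ∉ reached st → j ∈ new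
      new⁺ a j∉ = ∈-filter⁺ new? (∈-allFin _) (a , j∉)
      known+new : length known + length new ≤ degree G p
      known+new = subst (_≤ degree G p) (length-++ known) (length≤degree G
        (Unique.++⁺ uK (Unique.filter⁺ new? (Unique.allFin⁺ n)) λ (k∈ , j∈) → proj₂ (new⁻ j∈) (proj₁ (known-ok k∈)))
        λ j∈ → ∈-adj (∈-++⁻ known j∈))
        where
        ∈-adj : ∀ {j} → j ∈ known ⊎ j ∈ new → Adj G p j
        ∈-adj (inj₁ k∈) = proj₂ (known-ok k∈)
        ∈-adj (inj₂ j∈) = proj₁ (new⁻ j∈)
      closed⁺ : ∀ {i j} → i ∈ p ∷ processed st → Adj G i j → j ∈ new ++ reached st
      closed⁺ {j = j} (here refl) a with j ∈? reached st
      ... | yes j∈ = ∈-++⁺ʳ new j∈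
      ... | no j∉ = ∈-++⁺ˡ (new⁺ a j∉)
      closed⁺ (there i∈) a = ∈-++⁺ʳ new (closed st i∈ a)
      attached⁺ : ∀ {i} → i ∈ new ++ reached st → ∃ λ j → j ∈ new ++ reached st × Adj G i j
      attached⁺ i∈ with ∈-++⁻ new i∈
      ... | inj₁ i∈new = p , ∈-++⁺ʳ new p∈ , Adj-sym G (proj₁ (new⁻ i∈new))
      ... | inj₂ i∈old = let j , j∈ , a = attached st i∈old in j , ∈-++⁺ʳ new j∈ , a
      S = sum (map excessOf (processed st))
      result : ∀ xs → xs ≡ new → Σ (Stage base roots (slack + gain)) λ st′ → processed st′ ≡ p ∷ processed st
      -- Nothing remains to be chosen or forced. Here `known` only bounds `gain` below the degree,
      -- so the budget of `p` covers it through `gain≤`.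
      result [] new≡[] = record
        { free = free st
        ; reached = new ++ reached st
        ; processed = p ∷ processed st
        ; determined = λ x eqs zeros i∈ → determined st x (eqs ∘ there) zeros (subst (λ xs → _ ∈ xs ++ reached st) (≡.sym new≡[]) i∈)
        ; base⊆reached = ∈-++⁺ʳ new ∘ base⊆reached st
        ; roots⊆reached = ∈-++⁺ʳ new ∘ roots⊆reached st
        ; processed⊆reached = λ { (here refl) → ∈-++⁺ʳ new p∈ ; (there i∈) → ∈-++⁺ʳ new (processed⊆reached st i∈) }
        ; attached = attached⁺
        ; closed = closed⁺
        ; unique = ∷-unique p∉ (unique st)
        ; apart = apart st
        ; size = begin
            length base + length (free st) + (slack + gain)   ≡⟨ assoc (length base) (length (free st)) slack gain ⟩
            length base + length (free st) + slack + gain     ≤⟨ ℕ.+-mono-≤ (size st) gain≤ ⟩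
            2 * length roots + S + excessOf p                 ≡⟨ swap (2 * length roots) S (excessOf p) ⟩
            2 * length roots + (excessOf p + S)               ∎
        } , refl
        where
        open ℕ.≤-Reasoning
        assoc : ∀ a b c d → a + b + (c + d) ≡ a + b + c + d
        assoc = solve-∀
        swap : ∀ a b c → a + b + c ≡ a + (c + b)
        swap = solve-∀
      result (o ∷ os) o∷os≡new = record
        { free = os ++ free st
        ; reached = new ++ reached st
        ; processed = p ∷ processed st
        ; determined = determined⁺
        ; base⊆reached = ∈-++⁺ʳ new ∘ base⊆reached st
        ; roots⊆reached = ∈-++⁺ʳ new ∘ roots⊆reached st
        ; processed⊆reached = λ { (here refl) → ∈-++⁺ʳ new p∈ ; (there i∈) → ∈-++⁺ʳ new (processed⊆reached st i∈) }
        ; attached = attached⁺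
        ; closed = closed⁺
        ; unique = ∷-unique p∉ (unique st)
        ; apart = apart st
        ; size = begin
            length base + length (os ++ free st) + (slack + gain)          ≡⟨ cong (λ l → length base + l + (slack + gain)) (length-++ os) ⟩
            length base + (length os + length (free st)) + (slack + gain)  ≡⟨ assoc (length base) (length os) (length (free st)) slack gain ⟩
            length base + length (free st) + slack + (gain + length os)    ≤⟨ ℕ.+-mono-≤ (size st) gain+os≤ ⟩
            2 * length roots + S + excessOf p                              ≡⟨ swap (2 * length roots) S (excessOf p) ⟩
            2 * length roots + (excessOf p + S)                            ∎
        } , refl
        where
        open ℕ.≤-Reasoning
        assoc : ∀ a e b c d → a + (e + b) + (c + d) ≡ a + b + c + (d + e)
        assoc = solve-∀
        swap : ∀ a b c → a + b + c ≡ a + (c + b)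
        swap = solve-∀
        arrange : ∀ a b → 2 + (a + b) ≡ suc a + suc b
        arrange = solve-∀
        -- At least `suc gain` neighbours are known and one more, `o`, is forced; both units are
        -- paid for by the 2 subtracted in `excessOf`.
        gain+os≤ : gain + length os ≤ excessOf p
        gain+os≤ = ℕ.∸-monoˡ-≤ 2 (begin
          2 + (gain + length os)         ≡⟨ arrange gain (length os) ⟩
          suc gain + length (o ∷ os)     ≤⟨ ℕ.+-monoˡ-≤ (length (o ∷ os)) gain< ⟩
          length known + length (o ∷ os) ≡⟨ cong (λ xs → length known + length xs) o∷os≡new ⟩
          length known + length new      ≤⟨ known+new ⟩
          degree G p                     ∎)
        determined⁺ : ∀ x → (∀ {i} → i ∈ p ∷ processed st → row G x i ≡ 0ℚ) →
          (∀ {i} → i ∈ base ++ (os ++ free st) → x i ≡ 0ℚ) → ∀ {i} → i ∈ new ++ reached st → x i ≡ 0ℚ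
        determined⁺ x eqs zeros i∈ = conclude (∈-++⁻ new i∈)
          where
          old : ∀ {i} → i ∈ reached st → x i ≡ 0ℚ
          old = determined st x (eqs ∘ there) λ i∈ → zeros (weaken (∈-++⁻ base i∈))
            where
            weaken : ∀ {i} → i ∈ base ⊎ i ∈ free st → i ∈ base ++ (os ++ free st)
            weaken (inj₁ q) = ∈-++⁺ˡ q
            weaken (inj₂ q) = ∈-++⁺ʳ base (∈-++⁺ʳ os q)
          chosen : ∀ {i} → i ∈ os → x i ≡ 0ℚ
          chosen q = zeros (∈-++⁺ʳ base (∈-++⁺ˡ q))
          new⇒ : ∀ {i} → i ∈ new → i ∈ o ∷ os
          new⇒ = subst (_ ∈_) (≡.sym o∷os≡new)
          rest : ∀ {j} → Adj G p j → j ≢ o → x j ≡ 0ℚ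
          rest {j} a j≢o with j ∈? reached st
          ... | yes j∈ = old j∈
          ... | no j∉ with new⇒ (new⁺ a j∉)
          ...   | here e = contradiction e j≢o
          ...   | there q = chosen q
          conclude : ∀ {i} → i ∈ new ⊎ i ∈ reached st → x i ≡ 0ℚ
          conclude (inj₂ q) = old q
          conclude (inj₁ q) with new⇒ q
          ... | there r = chosen r
          ... | here refl = forced x (proj₁ (new⁻ q)) (eqs (here refl)) rest

    -- The neighbour supplied by `attached` is the one known neighbour that `process` requires when
    -- no gain is claimed.
    process-plain : ∀ {p} → p ∈ reached st → p ∉ processed st →
      Σ (Stage base roots slack) λ st′ → processed st′ ≡ p ∷ processed st
    process-plain p∈ p∉ with attached st p∈
    ... | j , j∈ , a = subst (λ s → Σ (Stage base roots s) λ st′ → processed st′ ≡ _ ∷ processed st) (ℕ.+-identityʳ slack)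
      (process p∈ p∉ (j ∷ []) 0 ([] ∷ []) (λ { (here refl) → j∈ , a }) ℕ.≤-refl z≤n)

    -- Choosing `r` and `u` costs two vertices, which the new root pays for. Both are reached at
    -- once, so `attached` holds for them.
    add-root : (∀ {i} → i ∈ reached st → i ∈ processed st) →
      ∀ {r u} → r ∉ reached st → Adj G r u → Stage base (r ∷ roots) slack
    add-root done {r} {u} r∉ a = record
      { free = r ∷ u ∷ free st
      ; reached = r ∷ u ∷ reached st
      ; processed = processed st
      ; determined = λ x eqs zeros → λ
          { (here refl) → zeros (∈-++⁺ʳ base (here refl))
          ; (there (here refl)) → zeros (∈-++⁺ʳ base (there (here refl)))
          ; (there (there i∈)) → determined st x eqs (λ j∈ → zeros (weaken (∈-++⁻ base j∈))) i∈ }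
      ; base⊆reached = there ∘ there ∘ base⊆reached st
      ; roots⊆reached = λ { (here refl) → here refl ; (there i∈) → there (there (roots⊆reached st i∈)) }
      ; processed⊆reached = there ∘ there ∘ processed⊆reached st
      ; attached = λ
          { (here refl) → u , there (here refl) , a
          ; (there (here refl)) → r , here refl , Adj-sym G a
          ; (there (there i∈)) → let j , j∈ , b = attached st i∈ in j , there (there j∈) , b }
      ; closed = λ i∈ b → there (there (closed st i∈ b))
      ; unique = unique st
      -- All reached vertices are processed, so the reached set is closed under adjacency; an old
      -- root connected to `r` would put `r` in it.
      ; apart = All.tabulate (λ s∈ reach → r∉ (closed⇒Reach G (_∈ reached st) (λ i∈ b → closed st (done i∈) b) (roots⊆reached st s∈) (Reach-sym G reach))) ∷ apart st
      ; size = begin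
          length base + (2 + length (free st)) + slack   ≡⟨ shift (length base) (length (free st)) slack ⟩
          2 + (length base + length (free st) + slack)   ≤⟨ ℕ.+-monoʳ-≤ 2 (size st) ⟩
          2 + (2 * length roots + S)                     ≡⟨ double (length roots) S ⟩
          2 * suc (length roots) + S                     ∎
      }
      where
      open ℕ.≤-Reasoning
      S = sum (map excessOf (processed st))
      shift : ∀ a b c → a + (2 + b) + c ≡ 2 + (a + b + c)
      shift = solve-∀
      double : ∀ a b → 2 + (2 * a + b) ≡ 2 * suc a + b
      double = solve-∀
      weaken : ∀ {i} → i ∈ base ⊎ i ∈ free st → i ∈ base ++ (r ∷ u ∷ free st)
      weaken (inj₁ q) = ∈-++⁺ˡ q
      weaken (inj₂ q) = ∈-++⁺ʳ base (there (there q))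

  empty-stage : Stage [] [] 0
  empty-stage = record
    { free = [] ; reached = [] ; processed = []
    ; determined = λ _ _ _ ()
    ; base⊆reached = λ () ; roots⊆reached = λ () ; processed⊆reached = λ ()
    ; attached = λ () ; closed = λ () ; unique = [] ; apart = [] ; size = z≤n }

  -- With both ends in `base`, they stay at the head of the determining list, where `prescribe` can
  -- assign their values.
  edge-stage : ∀ {v u} → Adj G v u → Stage (v ∷ u ∷ []) (v ∷ []) 0
  edge-stage {v} {u} a = record
    { free = [] ; reached = v ∷ u ∷ [] ; processed = []
    ; determined = λ _ _ zeros → zeros
    ; base⊆reached = id
    ; roots⊆reached = λ { (here refl) → here refl }
    ; processed⊆reached = λ ()
    ; attached = λ { (here refl) → u , there (here refl) , a ; (there (here refl)) → v , here refl , Adj-sym G a }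
    ; closed = λ () ; unique = [] ; apart = [] ∷ [] ; size = ℕ.≤-refl }

  fuel-step : ∀ {f} (ps : List (Fin n)) → n ≤ length ps + suc f → n ≤ suc (length ps) + f
  fuel-step {f} ps = subst (n ≤_) (ℕ.+-suc (length ps) f)

  -- The invariant is that processed vertices and fuel together number at least `n`. With no fuel
  -- left, the distinct processed vertices are all the vertices.
  fuel-empty : ∀ {p : Fin n} {ps} → n ≤ length ps + 0 → Unique ps → p ∈ ps
  fuel-empty {p} {ps} enough u with p ∈? ps
  ... | yes p∈ = p∈
  ... | no p∉ = contradiction (subst (n ≤_) (ℕ.+-identityʳ (length ps)) enough) (ℕ.<⇒≱ (unique-length≤n (∷-unique p∉ u)))

  -- Serves to postpone a vertex when `skip` is that vertex alone, and to sweep a whole component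
  -- when `skip` is empty. No root is added.
  explore : ∀ {base roots slack} (skip : List (Fin n)) (st : Stage base roots slack) →
    Σ (Stage base roots slack) λ st′ →
      (∀ {i} → i ∈ reached st′ → i ∉ skip → i ∈ processed st′) ×
      (∀ {i} → i ∈ processed st′ → i ∈ skip → i ∈ processed st)
  explore {base} {roots} {slack} skip st = go n st (ℕ.m≤n+m n _)
    where
    go : ∀ f (st : Stage base roots slack) → n ≤ length (processed st) + f →
      Σ (Stage base roots slack) λ st′ →
        (∀ {i} → i ∈ reached st′ → i ∉ skip → i ∈ processed st′) ×
        (∀ {i} → i ∈ processed st′ → i ∈ skip → i ∈ processed st)
    go zero st enough = st , (λ _ _ → fuel-empty enough (unique st)) , λ i∈ _ → i∈
    go (suc f) st enough with Fin.any? (λ p → (p ∈? reached st) ×-dec (¬? (p ∈? processed st) ×-dec ¬? (p ∈? skip)))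
    ... | no none = st , (λ {i} i∈ i∉ → decidable-stable (i ∈? processed st) λ i∉P → none (i , i∈ , i∉P , i∉)) , λ i∈ _ → i∈
    ... | yes (p , p∈ , p∉ , p∉skip) with process-plain st p∈ p∉
    ...   | st₁ , eq with go f st₁ (subst (λ ps → n ≤ length ps + f) (≡.sym eq) (fuel-step (processed st) enough))
    ...     | st₂ , done , old = st₂ , done , λ {i} i∈ i∈skip → drop-head i∈skip (subst (i ∈_) eq (old i∈ i∈skip))
      where
      drop-head : ∀ {i} → i ∈ skip → i ∈ p ∷ processed st → i ∈ processed st
      drop-head i∈skip (here refl) = contradiction i∈skip p∉skip
      drop-head _ (there q) = q

  module _ (neighbour : ∀ v → ∃ (Adj G v)) where

    complete : ∀ {base roots slack} → Stage base roots slack →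
      ∃ λ roots′ → Σ (Stage base roots′ slack) λ st → ∀ i → i ∈ processed st
    complete {base} {slack = slack} st = go n st (ℕ.m≤n+m n _)
      where
      go : ∀ f {roots} (st : Stage base roots slack) → n ≤ length (processed st) + f →
        ∃ λ roots′ → Σ (Stage base roots′ slack) λ st → ∀ i → i ∈ processed st
      go zero st enough = _ , st , λ _ → fuel-empty enough (unique st)
      go (suc f) st enough with Fin.any? (λ p → (p ∈? reached st) ×-dec ¬? (p ∈? processed st))
      ... | yes (p , p∈ , p∉) with process-plain st p∈ p∉
      ...   | st₁ , eq = go f st₁ (subst (λ ps → n ≤ length ps + f) (≡.sym eq) (fuel-step (processed st) enough))
      go (suc f) {roots} st enough | no none with Fin.any? (λ r → ¬? (r ∈? reached st))
      ...   | no all = roots , st , λ i → done (decidable-stable (i ∈? reached st) λ i∉ → all (i , i∉))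
        where
        done : ∀ {i} → i ∈ reached st → i ∈ processed st
        done {i} i∈ = decidable-stable (i ∈? processed st) λ i∉ → none (i , i∈ , i∉)
      -- The new root is processed at once, so that this step consumes fuel as well.
      ...   | yes (r , r∉) with process-plain (add-root st done r∉ (proj₂ (neighbour r))) (here refl) (r∉ ∘ processed⊆reached st)
        where
        done : ∀ {i} → i ∈ reached st → i ∈ processed st
        done {i} i∈ = decidable-stable (i ∈? processed st) λ i∉ → none (i , i∈ , i∉)
      ...     | st₁ , eq = go f st₁ (subst (λ ps → n ≤ length ps + f) (≡.sym eq) (fuel-step (processed st) enough))

    -- A completed stage reaches every vertex. Its roots lie in distinct components and no vertex is
    -- processed twice, which bounds the budget; the slack is carried along.
    determining-list : ∀ {base roots slack} → Stage base roots slack →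
      ∃ λ free → Determines G (lookup (base ++ free)) ×
        length (base ++ free) + slack ≤ 2 * components G + excess G
    determining-list {base} {slack = slack} st₀ with complete st₀
    ... | roots , st , all = free st , det , (begin
      length (base ++ free st) + slack                             ≡⟨ cong (_+ slack) (length-++ base) ⟩
      length base + length (free st) + slack                       ≤⟨ size st ⟩
      2 * length roots + sum (map excessOf (processed st))         ≤⟨ ℕ.+-mono-≤ (ℕ.*-monoʳ-≤ 2 (length≤components G (apart st))) (sum-map-⊆ excessOf (unique st) (λ _ → ∈-allFin _)) ⟩
      2 * components G + excess G                                  ∎)
      where
      open ℕ.≤-Reasoning
      det : Determines G (lookup (base ++ free st))
      det x ker zeros j = determined st x (λ {i} _ → ker i)
        (λ {i} i∈ → trans (cong x (lookup-index i∈)) (zeros (index i∈)))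
        (processed⊆reached st (all j))

-- The adjacency operator and its restriction to unions of components

module _ {n} (G : SignedGraph n) where

  row-cong : ∀ {x y : Fin n → ℚ} {i} → (∀ {j} → Adj G i j → x j ≡ y j) → row G x i ≡ row G y i
  row-cong {x} {y} {i} e = sumℚ-cong {n} term
    where
    term : ∀ j → A G i j *ℚ x j ≡ A G i j *ℚ y j
    term j with T? (adj G i j)
    ... | yes a = cong (A G i j *ℚ_) (e a)
    ... | no ¬a rewrite ¬Adj⇒A≡0 G ¬a = trans (ℚ.*-zeroˡ (x j)) (≡.sym (ℚ.*-zeroˡ (y j)))

  row-zero : ∀ {x : Fin n → ℚ} {i} → (∀ {j} → Adj G i j → x j ≡ 0ℚ) → row G x i ≡ 0ℚ
  row-zero {x} {i} z = sumℚ-zero {n} (λ j → A*-zero G x {i} {j} z)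

  row-self-adjoint : ∀ (x y : Fin n → ℚ) → sumℚ (λ i → y i *ℚ row G x i) ≡ sumℚ (λ j → x j *ℚ row G y j)
  row-self-adjoint x y = begin
    sumℚ (λ i → y i *ℚ row G x i)                        ≡⟨ sumℚ-cong {n} (λ i → sumℚ-*ˡ (y i) (λ j → A G i j *ℚ x j)) ⟨
    sumℚ (λ i → sumℚ (λ j → y i *ℚ (A G i j *ℚ x j)))    ≡⟨ sumℚ-swap (λ i j → y i *ℚ (A G i j *ℚ x j)) ⟩
    sumℚ (λ j → sumℚ (λ i → y i *ℚ (A G i j *ℚ x j)))    ≡⟨ sumℚ-cong {n} (λ j → sumℚ-cong {n} λ i → term i j) ⟩
    sumℚ (λ j → sumℚ (λ i → x j *ℚ (A G j i *ℚ y i)))    ≡⟨ sumℚ-cong {n} (λ j → sumℚ-*ˡ (x j) (λ i → A G j i *ℚ y i)) ⟩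
    sumℚ (λ j → x j *ℚ row G y j)                        ∎
    where
    open ≡-Reasoning
    rotate : ∀ a b c → a *ℚ (b *ℚ c) ≡ c *ℚ (b *ℚ a)
    rotate = solve 3 (λ a b c → a :* (b :* c) := c :* (b :* a)) refl
    term : ∀ i j → y i *ℚ (A G i j *ℚ x j) ≡ x j *ℚ (A G j i *ℚ y i)
    term i j = trans (rotate (y i) (A G i j) (x j)) (cong (λ a → x j *ℚ (a *ℚ y i)) (A-sym G i j))

  -- The image of `g` is closed under adjacency, so the equations at its vertices involve no other
  -- vertex. Kernel vectors can therefore be restricted to the induced subgraph and extended from it
  -- by zero.
  module ClosedEmbedding {m} (g : Fin m → Fin n) (g-injective : Injective _≡_ _≡_ g)
    (g-closed : ∀ i {x} → Adj G (g i) x → ∃ λ j → g j ≡ x) where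

    row-induce : ∀ (x : Fin n → ℚ) i → row G x (g i) ≡ row (induce G g) (x ∘ g) i
    row-induce x i = sumℚ-injection g g-injective (λ j → A G (g i) j *ℚ x j)
      λ j outside → A*-zero G x (λ a → let l , e = g-closed i a in contradiction e (outside l))

    restrict-InKernel : ∀ {x} → InKernel G x → InKernel (induce G g) (x ∘ g)
    restrict-InKernel {x} ker i = trans (≡.sym (row-induce x i)) (ker (g i))

    extend : (Fin m → ℚ) → Fin n → ℚ
    extend x j with Fin.any? (λ i → g i ≟ j)
    ... | yes (i , _) = x i
    ... | no _ = 0ℚ

    extend-inside : ∀ x i → extend x (g i) ≡ x i
    extend-inside x i with Fin.any? (λ l → g l ≟ g i)
    ... | yes (l , e) = cong x (g-injective e)
    ... | no none = contradiction (i , refl) none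

    extend-outside : ∀ x {j} → (∀ i → g i ≢ j) → extend x j ≡ 0ℚ
    extend-outside x {j} outside with Fin.any? (λ i → g i ≟ j)
    ... | yes (i , e) = contradiction e (outside i)
    ... | no _ = refl

    extend-InKernel : ∀ {x} → InKernel (induce G g) x → InKernel G (extend x)
    extend-InKernel {x} ker j with Fin.any? (λ i → g i ≟ j)
    ... | yes (i , refl) = trans (row-induce (extend x) i)
      (trans (sumℚ-cong {m} (λ l → cong (A G (g i) (g l) *ℚ_) (extend-inside x l))) (ker i))
    -- By symmetry of adjacency, a neighbour of `j` in the image would put `j` there too.
    ... | no none = row-zero {extend x} {j} λ a → extend-outside x
      λ { i refl → none (g-closed i (Adj-sym G a)) }

-- Graphs attaining the bound

open Stage

module Extremal {n} (G : SignedGraph n) (neighbour : ∀ v → ∃ (Adj G v))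
  {k} (vs : Fin k → Fin n → ℚ) (ker : ∀ i → InKernel G (vs i)) (indep : LinIndep vs)
  (large : 2 * components G + excess G ≤ k) where

  -- Slack would yield a determining list shorter than `k`, too short for `k` independent kernel
  -- vectors.
  slack≡0 : ∀ {base roots slack} → Stage G base roots slack → slack ≡ 0
  slack≡0 {base} {slack = slack} st = let free , det , size = determining-list G neighbour st in
    ℕ.n≤0⇒n≡0 (ℕ.+-cancelˡ-≤ (length (base ++ free)) slack 0 (begin
      length (base ++ free) + slack   ≤⟨ size ⟩
      2 * components G + excess G     ≤⟨ large ⟩
      k                               ≤⟨ indep-size≤ G (lookup (base ++ free)) det vs ker indep ⟩
      length (base ++ free)           ≡⟨ ℕ.+-identityʳ (length (base ++ free)) ⟨
      length (base ++ free) + 0       ∎))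
    where open ℕ.≤-Reasoning

  -- Started from the edge, zero forcing ends with a determining list of at most `k` vertices, on
  -- which all values are free. The remaining chosen vertices get 0.
  prescribe : ∀ {v u} → Adj G v u → ∀ a b → ∃ λ x → InKernel G x × x v ≡ a × x u ≡ b
  prescribe {v} {u} adjacent a b =
    let free , det , size = determining-list G neighbour (edge-stage G adjacent)
        x , x-ker , x-values = interpolate G (lookup (v ∷ u ∷ free)) det vs ker indep
          (ℕ.≤-trans (ℕ.m+n≤o⇒m≤o (length (v ∷ u ∷ free)) size) large) (values (length free))
    in x , x-ker , x-values zero , x-values (suc zero)
    where
    values : ∀ l → Fin (2 + l) → ℚ
    values _ zero = a
    values _ (suc zero) = b
    values _ (suc (suc _)) = 0ℚ

  -- Cut y down to the reached set: A maps the result to a nonzero multiple of the unit vector at v,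
  -- so by symmetry of A every kernel vector vanishes at v.
  module Separating {v u} (reached : List (Fin n)) (adjacent : Adj G v u) (u∈ : u ∈ reached)
    (closed-off : ∀ {i j} → i ∈ reached → i ≢ v → Adj G i j → j ∈ reached)
    (only-u : ∀ {j} → j ∈ reached → Adj G v j → j ≡ u)
    (y : Fin n → ℚ) (y-ker : InKernel G y) (yv : y v ≡ 0ℚ) (yu : y u ≡ 1ℚ) where

    open ≡-Reasoning

    cut : Fin n → ℚ
    cut i with i ∈? reached
    ... | yes _ = y i
    ... | no _ = 0ℚ

    cut-inside : ∀ {i} → i ∈ reached → cut i ≡ y i
    cut-inside {i} i∈ with i ∈? reached
    ... | yes _ = refl
    ... | no i∉ = contradiction i∈ i∉

    cut-outside : ∀ {i} → i ∉ reached → cut i ≡ 0ℚ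
    cut-outside {i} i∉ with i ∈? reached
    ... | yes i∈ = contradiction i∈ i∉
    ... | no _ = refl

    cut-row : ∀ {i} → i ≢ v → row G cut i ≡ 0ℚ
    cut-row {i} i≢v = by-cases (i ∈? reached)
      where
      -- A reached neighbour of `i` other than `v` would make `i` reached, so only `v` can be one,
      -- and `y` is 0 there.
      vanish : i ∉ reached → ∀ {j} → Adj G i j → Dec (j ≡ v) → Dec (j ∈ reached) → cut j ≡ 0ℚ
      vanish i∉ a _ (no j∉) = cut-outside j∉
      vanish i∉ a (yes refl) (yes j∈) = trans (cut-inside j∈) yv
      vanish i∉ a (no j≢v) (yes j∈) = contradiction (closed-off j∈ j≢v (Adj-sym G a)) i∉
      by-cases : Dec (i ∈ reached) → row G cut i ≡ 0ℚ
      by-cases (yes i∈) = trans (row-cong G {cut} {y} {i} λ a → cut-inside (closed-off i∈ i≢v a)) (y-ker i)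
      by-cases (no i∉) = row-zero G {cut} {i} λ {j} a → vanish i∉ a (j ≟ v) (j ∈? reached)

    cut-row-v : row G cut v ≡ A G v u
    cut-row-v = begin
      row G cut v        ≡⟨ sumℚ-single u (λ j → A G v j *ℚ cut j) (λ j j≢u → A*-zero G cut {v} {j} (λ a → cut-outside λ j∈ → j≢u (only-u j∈ a))) ⟩
      A G v u *ℚ cut u   ≡⟨ cong (A G v u *ℚ_) (trans (cut-inside u∈) yu) ⟩
      A G v u *ℚ 1ℚ      ≡⟨ ℚ.*-identityʳ (A G v u) ⟩
      A G v u            ∎

    vanishes-at-v : ∀ x → InKernel G x → x v ≡ 0ℚ
    vanishes-at-v x x-ker = *-nonzero-cancel (Adj⇒A≢0 G adjacent) (begin
      A G v u *ℚ x v                      ≡⟨ ℚ.*-comm (A G v u) (x v) ⟩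
      x v *ℚ A G v u                      ≡⟨ cong (x v *ℚ_) cut-row-v ⟨
      x v *ℚ row G cut v                  ≡⟨ sumℚ-single v (λ j → x j *ℚ row G cut j) (λ j j≢v → trans (cong (x j *ℚ_) (cut-row j≢v)) (ℚ.*-zeroʳ (x j))) ⟨
      sumℚ (λ j → x j *ℚ row G cut j)     ≡⟨ row-self-adjoint G x cut ⟨
      sumℚ (λ i → cut i *ℚ row G x i)     ≡⟨ sumℚ-zero {n} (λ i → trans (cong (cut i *ℚ_) (x-ker i)) (ℚ.*-zeroʳ (cut i))) ⟩
      0ℚ                                  ∎)

  -- `prescribe` supplies the vector `y` that `Separating` needs, and also a kernel vector with
  -- value 1 at `v`, where every kernel vector should vanish.
  no-separating-edge : ∀ {v u} (reached : List (Fin n)) → Adj G v u → u ∈ reached →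
    (∀ {i j} → i ∈ reached → i ≢ v → Adj G i j → j ∈ reached) →
    ¬ (∀ {j} → j ∈ reached → Adj G v j → j ≡ u)
  no-separating-edge reached adjacent u∈ closed-off only-u =
    let y , y-ker , yv , yu = prescribe adjacent 0ℚ 1ℚ
        x , x-ker , xv , _ = prescribe adjacent 1ℚ 0ℚ
    in 1≢0 (trans (≡.sym xv) (Separating.vanishes-at-v reached adjacent u∈ closed-off only-u y y-ker yv yu x x-ker))
    where
    1≢0 : 1ℚ ≢ 0ℚ
    1≢0 ()

  2-regular : ∀ v → degree G v ≡ 2
  2-regular v with neighbour v
  ... | u , adjacent with explore G (v ∷ []) (edge-stage G adjacent)
  ...   | st , done , fresh with Fin.any? (λ b → (b ∈? reached st) ×-dec (T? (adj G v b) ×-dec ¬? (b ≟ u)))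
  -- `u` is the only reached neighbour of `v`. Every reached vertex except `v` has been processed,
  -- so its neighbours are reached.
  ...     | no none = contradiction
      (λ {j} j∈ a → decidable-stable (j ≟ u) (λ j≢u → none (j , j∈ , a , j≢u)))
      (no-separating-edge (reached st) adjacent (base⊆reached st (there (here refl)))
        λ i∈ i≢v a → closed st (done i∈ λ { (here e) → i≢v e }) a)
  ...     | yes (b , b∈ , a , b≢u) = ℕ.≤-antisym (ℕ.≮⇒≥ at-most) (length≤degree G two λ
      { (here refl) → adjacent ; (there (here refl)) → a })
    where
    two : Unique (u ∷ b ∷ [])
    two = ((b≢u ∘ ≡.sym) ∷ []) ∷ ([] ∷ [])
    at-most : ¬ (2 < degree G v)
    at-most 3≤d = contradiction
      -- Two known neighbours are one more than necessary. If the degree is at least 3, processing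
      -- the postponed `v` now gains 1.
      (slack≡0 (proj₁ (process G st (base⊆reached st (here refl)) (λ v∈ → contradiction (fresh v∈ (here refl)) λ ())
        (u ∷ b ∷ []) 1 two
        (λ { (here refl) → base⊆reached st (there (here refl)) , adjacent ; (there (here refl)) → b∈ , a })
        ℕ.≤-refl (ℕ.∸-monoˡ-≤ 2 3≤d))))
      λ ()

-- Components of 2-regular graphs are cycles

module _ {n} (G : SignedGraph n) (deg2 : ∀ i → degree G i ≡ 2) where

  other-neighbour : ∀ {a i} → Adj G i a →
    ∃ λ o → o ≢ a × Adj G i o × (∀ {j} → Adj G i j → j ≡ a ⊎ j ≡ o)
  other-neighbour {a} {i} ia = pick (nbrs G i) (trans (≡.sym (degree≡length G i)) (deg2 i))
      (select-unique (adj G i)) (∈-select⁻ (adj G i)) (∈-select⁺ (adj G i))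
    where
    one-of : ∀ {j p q : Fin n} → j ∈ p ∷ q ∷ [] → j ≡ p ⊎ j ≡ q
    one-of (here e) = inj₁ e
    one-of (there (here e)) = inj₂ e
    pick : ∀ xs → length xs ≡ 2 → Unique xs → (∀ {j} → j ∈ xs → Adj G i j) → (∀ {j} → Adj G i j → j ∈ xs) →
      ∃ λ o → o ≢ a × Adj G i o × (∀ {j} → Adj G i j → j ≡ a ⊎ j ≡ o)
    pick (p ∷ q ∷ []) refl ((p≢q ∷ []) ∷ _) sound complete with complete ia
    ... | here refl = q , p≢q ∘ ≡.sym , sound (there (here refl)) , λ ij → one-of (complete ij)
    ... | there (here refl) = p , p≢q , sound (here refl) , λ ij → Sum.swap (one-of (complete ij))

  module Walk {v u} (vu : Adj G v u) where

    -- A walk that never turns back is determined by its current directed edge, so darts rather than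
    -- vertices are iterated.
    Dart : Set
    Dart = Σ (Fin n) λ a → Σ (Fin n) λ b → Adj G a b

    advance : Dart → Dart
    advance (a , b , ab) with other-neighbour (Adj-sym G ab)
    ... | o , _ , bo , _ = b , o , bo

    dart : ℕ → Dart
    dart zero = v , u , vu
    dart (suc i) = advance (dart i)

    walk : ℕ → Fin n
    walk i = proj₁ (dart i)

    walk-edge : ∀ i → Adj G (walk i) (walk (suc i))
    walk-edge i = proj₂ (proj₂ (dart i))

    walk-turn : ∀ i → walk (2 + i) ≢ walk i
    walk-turn i = proj₁ (proj₂ (other-neighbour (Adj-sym G (walk-edge i))))

    walk-neighbours : ∀ i {x} → Adj G (walk (suc i)) x → x ≡ walk i ⊎ x ≡ walk (2 + i)
    walk-neighbours i = proj₂ (proj₂ (proj₂ (other-neighbour (Adj-sym G (walk-edge i)))))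

    walk-Reach : ∀ i → Reach G v (walk i)
    walk-Reach zero = Reach-refl G
    walk-Reach (suc i) = Reach-step G (walk-Reach i) (walk-edge i)

    InjectiveBelow : ℕ → Set
    InjectiveBelow m = ∀ {i j} → i < m → j < m → walk i ≡ walk j → i ≡ j

    FirstRepeat : Set
    FirstRepeat = ∃ λ m → InjectiveBelow m × ∃ λ j → j < m × walk m ≡ walk j

    injective-or-repeat : ∀ m → InjectiveBelow m ⊎ FirstRepeat
    injective-or-repeat zero = inj₁ λ ()
    injective-or-repeat (suc m) with injective-or-repeat m
    ... | inj₂ rep = inj₂ rep
    ... | inj₁ inj with Fin.any? (λ (j : Fin m) → walk m ≟ walk (toℕ j))
    ...   | yes (j , e) = inj₂ (m , inj , toℕ j , Fin.toℕ<n j , e)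
    ...   | no none = inj₁ extended
      where
      fresh : ∀ {j} → j < m → walk m ≢ walk j
      fresh j<m e = none (fromℕ< j<m , trans e (cong walk (≡.sym (Fin.toℕ-fromℕ< j<m))))
      extended : InjectiveBelow (suc m)
      extended {i} {j} (s≤s i≤m) (s≤s j≤m) e with ℕ.m≤n⇒m<n∨m≡n i≤m | ℕ.m≤n⇒m<n∨m≡n j≤m
      ... | inj₁ i<m | inj₁ j<m = inj i<m j<m e
      ... | inj₁ i<m | inj₂ refl = contradiction (≡.sym e) (fresh i<m)
      ... | inj₂ refl | inj₁ j<m = contradiction e (fresh j<m)
      ... | inj₂ refl | inj₂ refl = refl

    first-repeat : FirstRepeat
    first-repeat with injective-or-repeat (suc n)
    ... | inj₂ rep = rep
    ... | inj₁ inj = contradiction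
      (Fin.injective⇒≤ {f = walk ∘ toℕ {suc n}} (λ e → Fin.toℕ-injective (inj (Fin.toℕ<n _) (Fin.toℕ<n _) e)))
      ℕ.1+n≰n

    -- If the walk first returned to a later position `suc j`, its last vertex before that would be
    -- a neighbour of `walk (suc j)`, hence `walk j` or `walk (2 + j)`. This contradicts
    -- injectivity, irreflexivity or `walk-turn`.
    repeat-at-start : ∀ {m} → InjectiveBelow m → ∀ {j} → j < m → walk m ≡ walk j → j ≡ 0
    repeat-at-start _ {zero} _ _ = refl
    repeat-at-start {suc m} inj {suc j} (s≤s j<m) e
      with walk-neighbours j (subst (λ x → Adj G x (walk m)) e (Adj-sym G (walk-edge m)))
    ... | inj₁ back = contradiction (inj ℕ.≤-refl (ℕ.m<n⇒m<1+n j<m) back)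
                        (ℕ.<⇒≢ j<m ∘ ≡.sym)
    ... | inj₂ forth with ℕ.m≤n⇒m<n∨m≡n j<m
    ...   | inj₂ refl = contradiction (≡.sym e) (Adj⇒≢ G (walk-edge (suc j)))
    ...   | inj₁ 2+j<m with refl ← inj ℕ.≤-refl (s≤s 2+j<m) forth = contradiction e (walk-turn (suc j))

    -- Return after one step would be a loop, and after two steps a reversal, so the length has the
    -- form `3 + m`.
    closing : ∃ λ m → InjectiveBelow (3 + m) × walk (3 + m) ≡ v
    closing with first-repeat
    ... | m , inj , j , j<m , e with refl ← repeat-at-start inj j<m e = long m inj e j<m
      where
      long : ∀ m → InjectiveBelow m → walk m ≡ v → 0 < m → ∃ λ m → InjectiveBelow (3 + m) × walk (3 + m) ≡ v
      long 1 _ e _ = contradiction (≡.sym e) (Adj⇒≢ G (walk-edge 0))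
      long 2 _ e _ = contradiction e (walk-turn 0)
      long (suc (suc (suc m))) inj e _ = m , inj , e

    module Closed (m′ : ℕ) (inj : InjectiveBelow (3 + m′)) (closes : walk (3 + m′) ≡ v) where

      m : ℕ
      m = 3 + m′

      g : Fin m → Fin n
      g = walk ∘ toℕ

      g-injective : Injective _≡_ _≡_ g
      g-injective e = Fin.toℕ-injective (inj (Fin.toℕ<n _) (Fin.toℕ<n _) e)

      CycAdjacent : Fin m → Fin m → Set
      CycAdjacent i j = CycSucc i j ⊎ CycSucc j i

      at : ∀ {t} (t<m : t < m) → g (fromℕ< t<m) ≡ walk t
      at t<m = cong walk (Fin.toℕ-fromℕ< t<m)

      -- `walk-neighbours` speaks only of positions after the first. At `v` the second neighbour
      -- comes from the closing edge, and differs from `walk 1` by injectivity.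
      start-neighbours : ∀ {x} → Adj G v x → x ≡ walk 1 ⊎ x ≡ walk (2 + m′)
      start-neighbours {x} vx with other-neighbour vu
      ... | o , _ , _ , only with only vx
                                | only (subst (λ y → Adj G y (walk (2 + m′))) closes (Adj-sym G (walk-edge (2 + m′))))
      ...   | inj₁ e | _ = inj₁ e
      ...   | inj₂ e | inj₂ e′ = inj₂ (trans e (≡.sym e′))
      ...   | inj₂ _ | inj₁ e′ = contradiction (inj {2 + m′} {1} ℕ.≤-refl (s≤s (s≤s z≤n)) e′) λ ()

      g-neighbours : ∀ i {x} → Adj G (g i) x → ∃ λ j → g j ≡ x × CycAdjacent i j
      g-neighbours zero a with start-neighbours a
      ... | inj₁ refl = suc zero , refl , inj₁ (inj₁ refl)
      ... | inj₂ refl = fromℕ< last , at last , inj₂ (inj₂ (cong suc (Fin.toℕ-fromℕ< last) , refl))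
        where
        last : 2 + m′ < m
        last = ℕ.≤-refl
      g-neighbours (suc i) a with walk-neighbours (toℕ i) a
      ... | inj₁ refl = fromℕ< i<m , at i<m , inj₂ (inj₁ (cong suc (≡.sym (Fin.toℕ-fromℕ< i<m))))
        where
        i<m : toℕ i < m
        i<m = ℕ.m<n⇒m<1+n (Fin.toℕ<n i)
      ... | inj₂ refl with ℕ.m≤n⇒m<n∨m≡n (Fin.toℕ<n (suc i))
      ...   | inj₁ i+2<m = fromℕ< i+2<m , at i+2<m , inj₁ (inj₁ (Fin.toℕ-fromℕ< i+2<m))
      ...   | inj₂ i+2≡m = zero , ≡.sym (trans (cong walk i+2≡m) closes) , inj₁ (inj₂ (i+2≡m , refl))

      CycSucc⇒Adj : ∀ i j → CycSucc i j → Adj G (g i) (g j)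
      CycSucc⇒Adj i j (inj₁ e) = subst (λ t → Adj G (g i) (walk t)) (≡.sym e) (walk-edge (toℕ i))
      CycSucc⇒Adj i j (inj₂ (i+1≡m , j≡0)) = subst (Adj G (g i))
        (trans (cong walk i+1≡m) (trans closes (cong walk (≡.sym j≡0)))) (walk-edge (toℕ i))

      isSignedCycle : IsSignedCycle (induce G g)
      -- `g` already lists the vertices in cyclic order, so the rearrangement is the identity.
      isSignedCycle = s≤s (s≤s (s≤s z≤n)) , id , id , λ i j → mk⇔
        (λ a → let l , e , c = g-neighbours i a in subst (CycAdjacent i) (g-injective e) c)
        [ CycSucc⇒Adj i j , Adj-sym G ∘ CycSucc⇒Adj j i ]′

      g-closed : ∀ i {x} → Adj G (g i) x → ∃ λ j → g j ≡ x
      g-closed i a = let j , e , _ = g-neighbours i a in j , e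

      g-image : ∀ x → Reach G v x ⇔ (∃ λ i → g i ≡ x)
      g-image x = mk⇔
        (closed⇒Reach G (λ x → ∃ λ i → g i ≡ x) (λ { (i , refl) → g-closed i }) (zero , refl))
        (λ { (i , refl) → walk-Reach (toℕ i) })

      open ClosedEmbedding G g g-injective g-closed

      ends : Fin 2 → Fin m
      ends zero = zero
      ends (suc zero) = suc zero

      -- Zero forcing in `G` from the edge at `v` sweeps the component. All degrees being 2, the
      -- budget has room for the two ends only; the argument is applied to the extension of `x` by
      -- zero.
      ends-determine : Determines (induce G g) ends
      ends-determine x x-ker x-zero i = trans (≡.sym (extend-inside x i))
          (determined st (extend x) (λ {j} _ → extend-InKernel {x} x-ker j) (zeros (free st) free≡[])
            (closed⇒Reach G (_∈ reached st) (λ i∈ a → closed st (done i∈ λ ()) a)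
              (base⊆reached st (here refl)) (walk-Reach (toℕ i))))
        where
        explored = explore G [] (edge-stage G vu)
        st = proj₁ explored
        done = proj₁ (proj₂ explored)
        sum≡0 : ∀ xs → sum (map (excessOf G) xs) ≡ 0
        sum≡0 [] = refl
        sum≡0 (y ∷ ys) = cong₂ _+_ (cong (_∸ 2) (deg2 y)) (sum≡0 ys)
        free≡[] : length (free st) ≡ 0
        free≡[] = ℕ.n≤0⇒n≡0 (ℕ.+-cancelˡ-≤ 2 _ _ (subst (_≤ 2) (ℕ.+-identityʳ _)
          (subst (λ s → 2 + length (free st) + 0 ≤ 2 + s) (sum≡0 (processed st)) (size st))))
        zeros : ∀ fs → length fs ≡ 0 → ∀ {j} → j ∈ v ∷ u ∷ fs → extend x j ≡ 0ℚ
        zeros [] _ (here refl) = trans (extend-inside x zero) (x-zero zero)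
        zeros [] _ (there (here refl)) = trans (extend-inside x (suc zero)) (x-zero (suc zero))

      -- The kernel vectors with values (1, 0) and (0, 1) at `v` and `u` stay independent on the
      -- cycle, and `ends-determine` excludes a third.
      nullity-2 : (∀ a b → ∃ λ x → InKernel G x × x v ≡ a × x u ≡ b) → Nullity (induce G g) 2
      nullity-2 prescribe = (ys , ys-ker , ys-indep) ,
          λ zs zs-ker zs-indep → contradiction (indep-size≤ (induce G g) ends ends-determine zs zs-ker zs-indep) ℕ.1+n≰n
        where
        X = prescribe 1ℚ 0ℚ
        Y = prescribe 0ℚ 1ℚ
        ys : Fin 2 → Fin m → ℚ
        ys zero = proj₁ X ∘ g
        ys (suc zero) = proj₁ Y ∘ g
        ys-ker : ∀ i → InKernel (induce G g) (ys i)
        ys-ker zero = restrict-InKernel {proj₁ X} (proj₁ (proj₂ X))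
        ys-ker (suc zero) = restrict-InKernel {proj₁ Y} (proj₁ (proj₂ Y))
        first : ∀ a b → a *ℚ 1ℚ +ℚ (b *ℚ 0ℚ +ℚ 0ℚ) ≡ a
        first = solve 2 (λ a b → a :* con 1ℚ :+ (b :* con 0ℚ :+ con 0ℚ) := a) refl
        second : ∀ a b → a *ℚ 0ℚ +ℚ (b *ℚ 1ℚ +ℚ 0ℚ) ≡ b
        second = solve 2 (λ a b → a :* con 0ℚ :+ (b :* con 1ℚ :+ con 0ℚ) := b) refl
        ys-indep : LinIndep ys
        ys-indep c rel zero = trans (≡.sym (first (c zero) (c (suc zero))))
          (trans (≡.sym (cong₂ (λ p q → c zero *ℚ p +ℚ (c (suc zero) *ℚ q +ℚ 0ℚ)) (proj₁ (proj₂ (proj₂ X))) (proj₁ (proj₂ (proj₂ Y))))) (rel zero))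
        ys-indep c rel (suc zero) = trans (≡.sym (second (c zero) (c (suc zero))))
          (trans (≡.sym (cong₂ (λ p q → c zero *ℚ p +ℚ (c (suc zero) *ℚ q +ℚ 0ℚ)) (proj₂ (proj₂ (proj₂ X))) (proj₂ (proj₂ (proj₂ Y))))) (rel (suc zero)))

nullity⇒cycles : ∀ {n} (G : SignedGraph n) → (∀ v → ∃ (Adj G v)) →
  Nullity G (2 * cyclomatic G + pendant G) → ∀ v → ComponentIsCycleNullity2 G v
nullity⇒cycles G neighbour ((vs , ker , indep) , _) v =
  m , g , g-injective , g-image , isSignedCycle , nullity-2 (prescribe vu)
  where
  positive : ∀ i → 1 ≤ degree G i
  positive i = length≤degree G {xs = proj₁ (neighbour i) ∷ []} ([] ∷ []) λ { (here refl) → proj₂ (neighbour i) }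
  -- The given independent family has 2c + p members, at least the zero forcing bound.
  open Extremal G neighbour vs ker indep (bound≤2c+p G positive)
  vu : Adj G v (proj₁ (neighbour v))
  vu = proj₂ (neighbour v)
  open Walk G 2-regular vu using (closing)
  open Walk.Closed G 2-regular vu (proj₁ closing) (proj₁ (proj₂ closing)) (proj₂ (proj₂ closing))

-- Disjoint unions of cycles of nullity 2

-- A missed element together with the image would give `suc m` distinct elements of `Fin m`.
injective⇒hits : ∀ {m} {π : Fin m → Fin m} → Injective _≡_ _≡_ π → ∀ i → ∃ λ a → π a ≡ i
injective⇒hits {m} {π} inj i with Fin.any? (λ a → π a ≟ i)
... | yes hit = hit
... | no none = contradiction (unique-length≤n (∷-unique {x = i} {map π (allFin m)} miss (Unique.map⁺ inj (Unique.allFin⁺ m))))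
    (subst (λ l → ¬ (suc l ≤ m)) (≡.sym (trans (length-map π (allFin m)) (length-tabulate {n = m} id))) ℕ.1+n≰n)
  where
  miss : i ∉ map π (allFin m)
  miss i∈ with ∈-map⁻ π i∈
  ... | a , _ , e = none (a , ≡.sym e)

module _ {m : ℕ} where

  ∃-CycSucc : (a : Fin m) → ∃ λ s → CycSucc a s
  ∃-CycSucc a with ℕ.m≤n⇒m<n∨m≡n (Fin.toℕ<n a)
  ... | inj₁ a+1<m = fromℕ< a+1<m , inj₁ (Fin.toℕ-fromℕ< a+1<m)
  ... | inj₂ a+1≡m = fromℕ< 0<m , inj₂ (a+1≡m , Fin.toℕ-fromℕ< 0<m)
    where
    0<m : 0 < m
    0<m = ℕ.≤-<-trans z≤n (Fin.toℕ<n a)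

  CycSucc-functional : ∀ {a s t : Fin m} → CycSucc a s → CycSucc a t → s ≡ t
  CycSucc-functional (inj₁ e) (inj₁ f) = Fin.toℕ-injective (trans e (≡.sym f))
  CycSucc-functional (inj₂ (_ , e)) (inj₂ (_ , f)) = Fin.toℕ-injective (trans e (≡.sym f))
  CycSucc-functional {s = s} (inj₁ e) (inj₂ (l , _)) = contradiction (trans e l) (ℕ.<⇒≢ (Fin.toℕ<n s))
  CycSucc-functional {t = t} (inj₂ (l , _)) (inj₁ e) = contradiction (trans e l) (ℕ.<⇒≢ (Fin.toℕ<n t))

  CycSucc-injective : ∀ {a b s : Fin m} → CycSucc a s → CycSucc b s → a ≡ b
  CycSucc-injective (inj₁ e) (inj₁ f) = Fin.toℕ-injective (ℕ.suc-injective (trans (≡.sym e) f))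
  CycSucc-injective (inj₂ (e , _)) (inj₂ (f , _)) = Fin.toℕ-injective (ℕ.suc-injective (trans e (≡.sym f)))
  CycSucc-injective (inj₁ e) (inj₂ (_ , z)) = contradiction (trans (≡.sym z) e) λ ()
  CycSucc-injective (inj₂ (_ , z)) (inj₁ e) = contradiction (trans (≡.sym z) e) λ ()

  -- The cyclic successor is an injective map of a finite set to itself, hence surjective.
  ∃-CycPred : (a : Fin m) → ∃ λ p → CycSucc p a
  ∃-CycPred a = let p , e = injective⇒hits {π = proj₁ ∘ ∃-CycSucc} next-injective a
                in p , subst (CycSucc p) e (proj₂ (∃-CycSucc p))
    where
    next-injective : Injective _≡_ _≡_ (proj₁ ∘ ∃-CycSucc)
    next-injective {a} {b} e = CycSucc-injective (proj₂ (∃-CycSucc a)) (subst (CycSucc b) (≡.sym e) (proj₂ (∃-CycSucc b)))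

  -- In length 2 the two elements succeed each other, and in length 1 the element succeeds itself.
  -- From length 3 on, successor and predecessor differ.
  CycSucc-asym : 3 ≤ m → ∀ {a s : Fin m} → CycSucc a s → ¬ CycSucc s a
  CycSucc-asym _ {a} {s} (inj₁ e) (inj₁ f) = ℕ.<-irrefl (trans f (cong suc e)) (ℕ.m<n⇒m<1+n (ℕ.n<1+n (toℕ a)))
  CycSucc-asym 3≤m (inj₁ e) (inj₂ (l , z)) = ℕ.<⇒≢ 3≤m (trans (≡.sym (cong (2 +_) z)) (trans (≡.sym (cong suc e)) l))
  CycSucc-asym 3≤m (inj₂ (l , z)) (inj₁ f) = ℕ.<⇒≢ 3≤m (trans (≡.sym (cong (2 +_) z)) (trans (≡.sym (cong suc f)) l))
  CycSucc-asym 3≤m (inj₂ (_ , z)) (inj₂ (l , _)) = ℕ.<⇒≢ (ℕ.<-trans ℕ.≤-refl 3≤m) (trans (≡.sym (cong suc z)) l)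

lookup-injective : ∀ {a} {X : Set a} {xs : List X} → Unique xs → ∀ {i j} → lookup xs i ≡ lookup xs j → i ≡ j
lookup-injective (_ ∷ _) {zero} {zero} _ = refl
lookup-injective {xs = _ ∷ xs} (x∉ ∷ _) {zero} {suc j} e = contradiction e (All.lookup x∉ (∈-lookup {xs = xs} j))
lookup-injective {xs = _ ∷ xs} (x∉ ∷ _) {suc i} {zero} e = contradiction (≡.sym e) (All.lookup x∉ (∈-lookup {xs = xs} i))
lookup-injective (_ ∷ u) {suc i} {suc j} e = cong suc (lookup-injective u e)

module _ {n} (G : SignedGraph n) where

  -- Neighbours of `v` are reachable, hence in the image of `g`; there they are the cyclic successor
  -- and predecessor, which are distinct.
  cycle-degree : ∀ {m v} {g : Fin m → Fin n} → Injective _≡_ _≡_ g →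
    (∀ u → Reach G v u ⇔ (∃ λ i → g i ≡ u)) → IsSignedCycle (induce G g) → degree G v ≡ 2
  cycle-degree {m} {v} {g} g-inj image (3≤m , π , π-inj , cyclic)
    with Equivalence.to (image v) (Reach-refl G)
  ... | i , refl with injective⇒hits π-inj i
  ...   | a , refl with ∃-CycSucc a | ∃-CycPred a
  ...     | s , as | p , pa = ℕ.≤-antisym
      (subst (_≤ 2) (≡.sym (degree≡length G _)) (length-⊆ (select-unique (adj G (h a))) only))
      (length≤degree G {h a} {h s ∷ h p ∷ []} (((λ e → s≢p (h-inj e)) ∷ []) ∷ ([] ∷ []))
        λ { (here refl) → Equivalence.from (cyclic a s) (inj₁ as)
          ; (there (here refl)) → Equivalence.from (cyclic a p) (inj₂ pa) })
    where
    h : Fin m → Fin n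
    h = g ∘ π
    h-inj : Injective _≡_ _≡_ h
    h-inj e = π-inj (g-inj e)
    s≢p : s ≢ p
    s≢p refl = CycSucc-asym 3≤m as pa
    only : ∀ {j} → j ∈ nbrs G (h a) → j ∈ h s ∷ h p ∷ []
    only {j} j∈ with ∈-select⁻ (adj G (h a)) j∈
    ... | aj with Equivalence.to (image j) (Reach-step G (Reach-refl G) aj)
    ...   | i , refl with injective⇒hits π-inj i
    ...     | b , refl with Equivalence.to (cyclic a b) aj
    ...       | inj₁ ab = here (cong h (CycSucc-functional ab as))
    ...       | inj₂ ba = there (here (cong h (CycSucc-injective ba pa)))

module _ {n} (G : SignedGraph n) (cycles : ∀ v → ComponentIsCycleNullity2 G v) where

  cycles⇒2-regular : ∀ v → degree G v ≡ 2
  cycles⇒2-regular v = let _ , _ , g-inj , image , cyclic , _ = cycles v in cycle-degree G g-inj image cyclic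

  nullity-upper : (∀ v → ∃ (Adj G v)) → ∀ {k} (vs : Fin k → Fin n → ℚ) → (∀ i → InKernel G (vs i)) →
    LinIndep vs → k ≤ 2 * components G
  nullity-upper neighbour {k} vs ker indep =
    let free , det , size = determining-list G neighbour (empty-stage G) in begin
    k                             ≤⟨ indep-size≤ G (lookup free) det vs ker indep ⟩
    length free                   ≡⟨ ℕ.+-identityʳ _ ⟨
    length free + 0               ≤⟨ size ⟩
    2 * components G + excess G   ≡⟨ cong (2 * components G +_) (excess≡0 G cycles⇒2-regular) ⟩
    2 * components G + 0          ≡⟨ ℕ.+-identityʳ _ ⟩
    2 * components G              ∎
    where open ℕ.≤-Reasoning

  leasts : List (Fin n)
  leasts = select (isLeast G)

  -- Indexing by least vertices selects every component exactly once.
  module Component (r : Fin (length leasts)) where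
    root : Fin n
    root = lookup leasts r
    comp : ComponentIsCycleNullity2 G root
    comp = cycles root
    order : ℕ
    order = proj₁ comp
    g : Fin order → Fin n
    g = proj₁ (proj₂ comp)
    g-injective : Injective _≡_ _≡_ g
    g-injective = proj₁ (proj₂ (proj₂ comp))
    image : ∀ u → Reach G root u ⇔ (∃ λ i → g i ≡ u)
    image = proj₁ (proj₂ (proj₂ (proj₂ comp)))
    basis : Σ (Fin 2 → Fin order → ℚ) λ v → (∀ i → InKernel (induce G g) (v i)) × LinIndep v
    basis = proj₁ (proj₂ (proj₂ (proj₂ (proj₂ (proj₂ comp)))))
    g-Reach : ∀ i → Reach G root (g i)
    g-Reach i = Equivalence.from (image (g i)) (i , refl)
    g-closed : ∀ i {x} → Adj G (g i) x → ∃ λ j → g j ≡ x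
    g-closed i {x} a = Equivalence.to (image x) (Reach-step G (g-Reach i) a)
    open ClosedEmbedding G g g-injective g-closed public
    vector : Fin 2 → Fin n → ℚ
    vector a = extend (proj₁ basis a)

  open Component

  root-injective : ∀ {r s} → Reach G (root r) (root s) → r ≡ s
  root-injective {r} {s} reach = lookup-injective (select-unique (isLeast G))
    (isLeast-unique G (least r) (least s) reach)
    where
    least : ∀ r → T (isLeast G (root r))
    least r = ∈-select⁻ (isLeast G) (∈-lookup {xs = leasts} r)

  vectors : Fin (2 * length leasts) → Fin n → ℚ
  vectors i = let a , r = remQuot (length leasts) i in vector r a

  at : Fin 2 → Fin (length leasts) → Fin (2 * length leasts)
  at = combine

  vectors-at : ∀ a r j → vectors (at a r) j ≡ vector r a j
  vectors-at a r j = cong (λ ar → vector (proj₂ ar) (proj₁ ar) j) (Fin.remQuot-combine a r)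

  vectors-InKernel : ∀ i → InKernel G (vectors i)
  vectors-InKernel i = let a , r = remQuot (length leasts) i in
    extend-InKernel r {proj₁ (basis r) a} (proj₁ (proj₂ (basis r)) a)

  -- At the vertices of one component all vectors of the other components vanish, which leaves a
  -- relation between the two basis vectors of its cycle.
  vectors-LinIndep : LinIndep vectors
  vectors-LinIndep c rel i = trans (cong c (≡.sym (Fin.combine-remQuot {2} (length leasts) i)))
      (block (proj₂ (remQuot {2} (length leasts) i)) (proj₁ (remQuot {2} (length leasts) i)))
    where
    open ≡-Reasoning
    block : ∀ r a → c (at a r) ≡ 0ℚ
    block r = proj₂ (proj₂ (basis r)) (λ a → c (at a r)) λ l → begin
      sumℚ (λ a → c (at a r) *ℚ proj₁ (basis r) a l)
        ≡⟨ sumℚ-cong {2} {λ a → c (at a r) *ℚ vectors (at a r) (g r l)} {λ a → c (at a r) *ℚ proj₁ (basis r) a l} (λ a → cong (c (at a r) *ℚ_) (trans (vectors-at a r (g r l)) (extend-inside r (proj₁ (basis r) a) l))) ⟨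
      sumℚ (λ a → c (at a r) *ℚ vectors (at a r) (g r l))
        ≡⟨ sumℚ-injection (λ a → at a r) (λ {a} {b} e → Fin.combine-injectiveˡ a r b r e) (λ i → c i *ℚ vectors i (g r l)) (other l) ⟨
      sumℚ (λ i → c i *ℚ vectors i (g r l))
        ≡⟨ rel (g r l) ⟩
      0ℚ ∎
      where
      other : ∀ l i → (∀ a → at a r ≢ i) → c i *ℚ vectors i (g r l) ≡ 0ℚ
      other l i outside with Fin.combine-surjective {2} {length leasts} i
      ... | b , s , refl = trans (cong (c (at b s) *ℚ_)
              (trans (vectors-at b s (g r l)) (extend-outside s (proj₁ (basis s) b) disjoint)))
            (ℚ.*-zeroʳ (c (at b s)))
        where
        disjoint : ∀ i → g s i ≢ g r l
        -- A common vertex would connect the two roots, so `s` would be `r`, although the index lies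
        -- outside the block of `r`.
        disjoint i e with refl ← root-injective {s} {r} (Reach-trans G (g-Reach s i)
          (subst (λ x → Reach G x (root r)) (≡.sym e) (Reach-sym G (g-Reach r l)))) = outside b refl

  cycles⇒nullity : (∀ v → ∃ (Adj G v)) → Nullity G (2 * cyclomatic G + pendant G)
  cycles⇒nullity neighbour = subst (Nullity G)
    (≡.sym (trans (2-regular⇒2c+p G cycles⇒2-regular) (cong (2 *_) (components≡length G))))
    ((vectors , vectors-InKernel , vectors-LinIndep) , λ vs ker indep → contradiction
      (subst (λ ω → suc (2 * length leasts) ≤ 2 * ω) (components≡length G) (nullity-upper neighbour vs ker indep))
      ℕ.1+n≰n)

-- The equivalence

theorem5p1 : (n : ℕ) (G : SignedGraph n) →
    (∀ v → ∃ λ u → ¬ (u ≡ v) × Reach G v u) →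
    Nullity G (2 * cyclomatic G + pendant G) ⇔ (∀ v → ComponentIsCycleNullity2 G v)
theorem5p1 n G nontrivial = mk⇔ (nullity⇒cycles G neighbour) (λ cycles → cycles⇒nullity G cycles neighbour)
  where
  -- The first edge of a walk to another vertex of the component shows that no vertex is isolated.
  neighbour : ∀ v → ∃ (Adj G v)
  neighbour v = let u , u≢v , reach = nontrivial v in ∃-neighbour G u≢v reach
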